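{- As formal power series in $q$, \[ \frac{(1,0,63,q)-(7,0,9,q)}{2}=q\,E(-q^3)\,E(-q^{21}). \]
   Context: For a binary quadratic form $(a,b,c)$, i.e. $ax^2+bxy+cy^2$, its theta series is $(a,b,c,q):=\sum_{x,y\in\mathbb{Z}}q^{ax^2+bxy+cy^2}$. Here $E(q):=\prod_{n=1}^{\infty}(1-q^n)$, so $E(-q^k)=\prod_{n=1}^{\infty}(1-(-q^k)^n)$. -}

module Defs where

open import Data.Nat as ℕ using (ℕ; zero; suc)
open import Data.Integer as ℤ using (ℤ; +_; _-_; -_)
open import Data.List using (List; []; _∷_; map; upTo; filter; length; foldr; concatMap)
open import Data.Product using (_×_; _,_)
open import Relation.Nullary using (yes; no)

Series : Set
Series = ℕ → ℤ

sumℤ : List ℤ → ℤ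
sumℤ = foldr ℤ._+_ (+ 0)

_⊛_ : Series → Series → Series
(f ⊛ g) n = sumℤ (map (λ i → f i ℤ.* g (n ℕ.∸ i)) (upTo (suc n)))

one : Series
one zero    = + 1
one (suc _) = + 0

monomial : ℕ → Series
monomial m n with m ℕ.≟ n
... | yes _ = + 1
... | no  _ = + 0

negS : Series → Series
negS f n = - f n

_⊖_ : Series → Series → Series
(f ⊖ g) n = f n - g n

powS : Series → ℕ → Series
powS f zero    = one
powS f (suc k) = f ⊛ powS f k

partialE : Series → ℕ → Series
partialE f zero    = one
partialE f (suc N) = partialE f N ⊛ (one ⊖ powS f (suc N))

-- E(f) = ∏_{k≥1} (1 - f^k) for a series f with zero constant term:
-- the coefficient of q^n is that of the partial product over k ≤ n
-- (the factors with k > n are ≡ 1 mod q^{n+1}).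
Esub : Series → Series
Esub f n = partialE f n n

E : Series
E = Esub (monomial 1)

qTimes : Series → Series
qTimes f zero    = + 0
qTimes f (suc n) = f n

range : ℕ → List ℤ
range n = map (λ i → (+ i) - (+ n)) (upTo (suc (n ℕ.+ n)))

-- theta series of the binary quadratic form (a,b,c):
-- coefficient of q^n = #{(x,y) ∈ ℤ² : a x² + b x y + c y² = n}.
-- The search box |x|,|y| ≤ n is exhaustive for positive definite forms
-- with a, c ≥ 1 and b = 0 (as used here), since then x² ≤ a x² ≤ n.
theta : ℤ → ℤ → ℤ → Series
theta a b c n =
  + length (filter (λ p → Q p ℤ.≟ (+ n))
    (concatMap (λ x → map (λ y → (x , y)) (range n)) (range n)))
  where
  Q : ℤ × ℤ → ℤ
  Q (x , y) = a ℤ.* x ℤ.* x ℤ.+ b ℤ.* x ℤ.* y ℤ.+ c ℤ.* y ℤ.* y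

{-# OPTIONS --safe #-}
module Submission where

-- By the pentagonal number theorem the coefficient of q^n on the right is twice the sum of ε(k) ε(l)
-- over the (k , l) ∈ ℤ² with (6k − 1)² + 7 (6l − 1)² = 8n, where ε(k) = 1 if k ≡ 0, 1 and ε(k) = −1
-- if k ≡ 2, 3 (mod 4). Hence the sign is +, −, +, − on the classes k − l ≡ 0, k − l ≡ 2, k + l ≡ 1,
-- k + l ≡ 3 (mod 4). Multiplication by 1 − √−7 puts the classes k − l ≡ 0 and
-- k + l ≡ 3 in bijection with the solutions, up to sign, of x² + 63y² = n and of
-- 7x² + 9y² = n with x + y odd and 3 ∤ x. Let G be the set of (w , z) with
-- 2 (9w² + 3wz + 2z²) = n and z ≡ 1 (mod 3). Sorted by the parity of w, it consists of the solutions,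
-- up to sign, of x² + 63y² = n with x + y even and 3 ∤ x, and of the class k − l ≡ 2; sorted by the
-- parity of w + z, it consists of the solutions of 7x² + 9y² = n of the same kind and of the class
-- k + l ≡ 1. Counting G in both ways, and noting that the solutions with 3 ∣ x of the two forms
-- are equinumerous, gives the identity.

open import Defs
open import Data.Empty using (⊥-elim)
open import Data.Integer as ℤ using (ℤ; +_; -[1+_]; _+_; _*_; _-_; -_; ∣_∣; 0ℤ; 1ℤ; -1ℤ)
open import Data.Integer.DivMod using (_/ℕ_; _%ℕ_; n%ℕd<d; a≡a%ℕn+[a/ℕn]*n)
import Data.Integer.Properties as ℤₚ
open import Algebra.Properties.AbelianGroup ℤₚ.+-0-abelianGroup using () renaming (∙-cancelʳ to +-cancelʳ)
open import Data.Integer.Tactic.RingSolver using (solve-∀)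
open import Data.List using (List; []; _∷_; map; upTo; filter; length; concatMap; cartesianProduct; _++_)
open import Data.List.Membership.Propositional using (_∈_)
open import Data.List.Membership.Propositional.Properties using (∈-map⁺; ∈-map⁻; ∈-++⁺ˡ; ∈-++⁺ʳ; ∈-upTo⁺; ∈-upTo⁻; ∈-cartesianProduct⁺)
open import Data.List.Membership.Propositional.Properties.WithK using (unique∧set⇒bag)
open import Data.List.Properties using (map-upTo; map-applyUpTo; map-∘)
open import Data.List.Relation.Binary.BagAndSetEquality using (∼bag⇒↭)
open import Data.List.Relation.Binary.Permutation.Propositional as Perm using (_↭_)
open import Data.List.Relation.Unary.All as All using ([]; _∷_)
open import Data.List.Relation.Unary.AllPairs using ([]; _∷_)
open import Data.List.Relation.Unary.Any using (here; there)
open import Data.List.Relation.Unary.Unique.Propositional using (Unique)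
import Data.List.Relation.Unary.Unique.Propositional.Properties as Unique
open import Data.Nat as ℕ using (ℕ; zero; suc; z≤n; s≤s; z<s; s<s)
import Data.Nat.Divisibility as ℕ∣
import Data.Nat.Properties as ℕₚ
open import Data.Nat.Tactic.RingSolver using () renaming (solve-∀ to solveℕ-∀)
open import Data.Product using (Σ; _×_; _,_; proj₁; proj₂)
open import Data.Sum using (_⊎_; inj₁; inj₂; [_,_]′; swap)
open import Data.Sum.Function.Propositional using (_⊎-↔_)
open import Data.Sum.Properties using (inj₁-injective; inj₂-injective)
open import Function using (_∘_)
open import Function.Bundles using (_↔_; Inverse; mk↔ₛ′; mk⇔)
open import Function.Construct.Composition using (_↔-∘_)
open import Function.Construct.Identity using (↔-id)
open import Function.Construct.Symmetry using (↔-sym)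
open import Relation.Binary.PropositionalEquality using (_≡_; _≢_; refl; sym; trans; cong; cong₂; subst; module ≡-Reasoning)
open import Relation.Binary.PropositionalEquality.WithK using (≡-irrelevant)
open import Relation.Nullary using (¬_; Dec; yes; no; contradiction)
open import Relation.Unary using (Decidable)

open Inverse using (to; from; strictlyInverseˡ; strictlyInverseʳ)


-- Finite sums over lists

∑ : {A : Set} → List A → (A → ℤ) → ℤ
∑ xs f = sumℤ (map f xs)

∑-cong-∈ : {A : Set} {f g : A → ℤ} (xs : List A) → (∀ {x} → x ∈ xs → f x ≡ g x) → ∑ xs f ≡ ∑ xs g
∑-cong-∈ []       f≗g = refl
∑-cong-∈ (x ∷ xs) f≗g = cong₂ _+_ (f≗g (here refl)) (∑-cong-∈ xs (f≗g ∘ there))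

∑-cong : {A : Set} {f g : A → ℤ} (xs : List A) → (∀ x → f x ≡ g x) → ∑ xs f ≡ ∑ xs g
∑-cong xs f≗g = ∑-cong-∈ xs (λ {x} _ → f≗g x)

∑-zero : {A : Set} (xs : List A) → ∑ xs (λ _ → 0ℤ) ≡ 0ℤ
∑-zero []       = refl
∑-zero (x ∷ xs) = trans (ℤₚ.+-identityˡ _) (∑-zero xs)

∑-+ : {A : Set} (f g : A → ℤ) (xs : List A) → ∑ xs (λ x → f x + g x) ≡ ∑ xs f + ∑ xs g
∑-+ f g []       = refl
∑-+ f g (x ∷ xs) = trans (cong (_+_ (f x + g x)) (∑-+ f g xs)) (interchange (f x) (g x) (∑ xs f) (∑ xs g))
  where
  interchange : ∀ a b c d → (a + b) + (c + d) ≡ (a + c) + (b + d)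
  interchange = solve-∀

∑-*ˡ : {A : Set} (c : ℤ) (f : A → ℤ) (xs : List A) → ∑ xs (λ x → c * f x) ≡ c * ∑ xs f
∑-*ˡ c f []       = sym (ℤₚ.*-zeroʳ c)
∑-*ˡ c f (x ∷ xs) = trans (cong (_+_ (c * f x)) (∑-*ˡ c f xs)) (sym (ℤₚ.*-distribˡ-+ c (f x) (∑ xs f)))

∑-*ʳ : {A : Set} (c : ℤ) (f : A → ℤ) (xs : List A) → ∑ xs (λ x → f x * c) ≡ ∑ xs f * c
∑-*ʳ c f xs = trans (∑-cong xs (λ x → ℤₚ.*-comm (f x) c)) (trans (∑-*ˡ c f xs) (ℤₚ.*-comm c (∑ xs f)))

∑-swap : {A B : Set} (f : A → B → ℤ) (xs : List A) (ys : List B) →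
  ∑ xs (λ x → ∑ ys (f x)) ≡ ∑ ys (λ y → ∑ xs (λ x → f x y))
∑-swap f []       ys = sym (∑-zero ys)
∑-swap f (x ∷ xs) ys = trans (cong (_+_ (∑ ys (f x))) (∑-swap f xs ys)) (sym (∑-+ (f x) _ ys))

∑-++ : {A : Set} (f : A → ℤ) (xs ys : List A) → ∑ (xs ++ ys) f ≡ ∑ xs f + ∑ ys f
∑-++ f []       ys = sym (ℤₚ.+-identityˡ _)
∑-++ f (x ∷ xs) ys = trans (cong (_+_ (f x)) (∑-++ f xs ys)) (sym (ℤₚ.+-assoc (f x) _ _))

∑-map : {A B : Set} (g : A → B) (f : B → ℤ) (xs : List A) → ∑ (map g xs) f ≡ ∑ xs (f ∘ g)
∑-map g f xs = cong sumℤ (sym (map-∘ xs))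

∑-cartesianProduct : {A B : Set} (f : A × B → ℤ) (xs : List A) (ys : List B) →
  ∑ (cartesianProduct xs ys) f ≡ ∑ xs (λ x → ∑ ys (λ y → f (x , y)))
∑-cartesianProduct f []       ys = refl
∑-cartesianProduct f (x ∷ xs) ys = trans (∑-++ f (map (x ,_) ys) _)
  (cong₂ _+_ (∑-map (x ,_) f ys) (∑-cartesianProduct f xs ys))

∑-↭ : {A : Set} (f : A → ℤ) {xs ys : List A} → xs ↭ ys → ∑ xs f ≡ ∑ ys f
∑-↭ f Perm.refl         = refl
∑-↭ f (Perm.prep x p)   = cong (_+_ (f x)) (∑-↭ f p)
∑-↭ f (Perm.swap x y p)   = trans (cong (λ s → f x + (f y + s)) (∑-↭ f p)) (exchange (f x) (f y) _)
  where
  exchange : ∀ a b c → a + (b + c) ≡ b + (a + c)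
  exchange = solve-∀
∑-↭ f (Perm.trans p q)  = trans (∑-↭ f p) (∑-↭ f q)

-- Formal power series: convolution and multiplication by q^c

infix 4 _≋_
_≋_ : Series → Series → Set
f ≋ g = ∀ n → f n ≡ g n

monomial-≡ : ∀ {m n} → m ≡ n → monomial m n ≡ 1ℤ
monomial-≡ {m} {n} m≡n with m ℕ.≟ n
... | yes _   = refl
... | no  m≢n = contradiction m≡n m≢n

monomial-≢ : ∀ {m n} → m ≢ n → monomial m n ≡ 0ℤ
monomial-≢ {m} {n} m≢n with m ℕ.≟ n
... | yes m≡n = contradiction m≡n m≢n
... | no  _   = refl

⊛-zero : ∀ g h → (g ⊛ h) 0 ≡ g 0 * h 0
⊛-zero g h = ℤₚ.+-identityʳ _

-- Splitting off the term i = 0 leaves a convolution whose left factor is advanced by one index,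
-- which allows induction on n in `⊛-oneʳ` and `⊛-qTimesʳ`.
⊛-suc : ∀ g h n → (g ⊛ h) (suc n) ≡ g 0 * h (suc n) + ((g ∘ suc) ⊛ h) n
⊛-suc g h n = cong (λ xs → g 0 * h (suc n) + sumℤ xs)
  (trans (map-applyUpTo suc F (suc n)) (sym (map-upTo (F ∘ suc) (suc n))))
  where
  F : ℕ → ℤ
  F i = g i * h (suc n ℕ.∸ i)

⊛-congʳ : ∀ g {h k} → h ≋ k → g ⊛ h ≋ g ⊛ k
⊛-congʳ g h≋k n = ∑-cong (upTo (suc n)) (λ i → cong (g i *_) (h≋k (n ℕ.∸ i)))

⊛-negSʳ : ∀ g h → g ⊛ negS h ≋ negS (g ⊛ h)
⊛-negSʳ g h n = trans
  (∑-cong (upTo (suc n)) (λ i → lemma (g i) (h (n ℕ.∸ i))))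
  (trans (∑-*ˡ -1ℤ (λ i → g i * h (n ℕ.∸ i)) (upTo (suc n))) (ℤₚ.-1*i≡-i ((g ⊛ h) n)))
  where
  lemma : ∀ a b → a * (- b) ≡ -1ℤ * (a * b)
  lemma = solve-∀

⊛-⊖ʳ : ∀ g h k → g ⊛ (h ⊖ k) ≋ (g ⊛ h) ⊖ (g ⊛ k)
⊛-⊖ʳ g h k n = trans
  (∑-cong (upTo (suc n)) (λ i → ℤₚ.*-distribˡ-+ (g i) (h (n ℕ.∸ i)) (- k (n ℕ.∸ i))))
  (trans (∑-+ (λ i → g i * h (n ℕ.∸ i)) (λ i → g i * - k (n ℕ.∸ i)) (upTo (suc n))) (cong (_+_ ((g ⊛ h) n)) (⊛-negSʳ g k n)))

⊛-oneʳ : ∀ g → g ⊛ one ≋ g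
⊛-oneʳ g zero    = trans (⊛-zero g one) (ℤₚ.*-identityʳ (g 0))
⊛-oneʳ g (suc n) = trans (⊛-suc g one n)
  (trans (cong₂ _+_ (ℤₚ.*-zeroʳ (g 0)) (⊛-oneʳ (g ∘ suc) n)) (ℤₚ.+-identityˡ _))

⊛-qTimesʳ : ∀ g h → g ⊛ qTimes h ≋ qTimes (g ⊛ h)
⊛-qTimesʳ g h zero          = trans (⊛-zero g (qTimes h)) (ℤₚ.*-zeroʳ (g 0))
⊛-qTimesʳ g h (suc zero)    = trans (⊛-suc g (qTimes h) 0)
  (cong (_+_ (g 0 * h 0)) (⊛-qTimesʳ (g ∘ suc) h 0))
⊛-qTimesʳ g h (suc (suc n)) = trans (⊛-suc g (qTimes h) (suc n))
  (trans (cong (_+_ (g 0 * h (suc n))) (⊛-qTimesʳ (g ∘ suc) h (suc n))) (sym (⊛-suc g h n)))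

-- Multiplication by q^c, as a displacement of coefficients instead of a convolution.
shift : ℕ → Series → Series
shift zero    g = g
shift (suc c) g = qTimes (shift c g)

qTimes-cong : ∀ {g h} → g ≋ h → qTimes g ≋ qTimes h
qTimes-cong g≋h zero    = refl
qTimes-cong g≋h (suc n) = g≋h n

shift-cong : ∀ c {g h} → g ≋ h → shift c g ≋ shift c h
shift-cong zero    g≋h = g≋h
shift-cong (suc c) g≋h = qTimes-cong (shift-cong c g≋h)

shift-⊖ : ∀ c g h → shift c (g ⊖ h) ≋ shift c g ⊖ shift c h
shift-⊖ zero    g h n       = refl
shift-⊖ (suc c) g h zero    = refl
shift-⊖ (suc c) g h (suc n) = shift-⊖ c g h n

shift-+ : ∀ c d g → shift (c ℕ.+ d) g ≡ shift c (shift d g)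
shift-+ zero    d g = refl
shift-+ (suc c) d g = cong qTimes (shift-+ c d g)

shift-< : ∀ c g {n} → n ℕ.< c → shift c g n ≡ 0ℤ
shift-< (suc c) g {zero}  n<c       = refl
shift-< (suc c) g {suc n} (s<s n<c) = shift-< c g n<c

shift-one : ∀ c → shift c one ≋ monomial c
shift-one zero    zero    = refl
shift-one zero    (suc n) = refl
shift-one (suc c) zero    = refl
shift-one (suc c) (suc n) with c ℕ.≟ n
... | yes c≡n = trans (shift-one c n) (trans (monomial-≡ c≡n) (sym (monomial-≡ (cong suc c≡n))))
... | no  c≢n = trans (shift-one c n) (trans (monomial-≢ c≢n) (sym (monomial-≢ (c≢n ∘ ℕₚ.suc-injective))))

⊛-shiftʳ : ∀ c g h → g ⊛ shift c h ≋ shift c (g ⊛ h)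
⊛-shiftʳ zero    g h n = refl
⊛-shiftʳ (suc c) g h n = trans (⊛-qTimesʳ g (shift c h) n) (qTimes-cong (⊛-shiftʳ c g h) n)

-- The pentagonal number theorem for E(-q^c)

sgn : ℕ → ℤ
sgn zero    = 1ℤ
sgn (suc n) = - sgn n

tri : ℕ → ℕ
tri zero    = 0
tri (suc s) = suc s ℕ.+ tri s

-- the generalized pentagonal number k(3k − 1)/2
pent : ℤ → ℕ
pent (+ zero)  = 0
pent (+ suc s) = suc s ℕ.* suc s ℕ.+ tri s
pent -[1+ s ]  = suc s ℕ.* suc s ℕ.+ tri (suc s)

-- Listed in layers, so that the step from N to N + 1 in `G-pent` adds exactly the two terms of
-- `pair (suc N)`.
ball : ℕ → List ℤ
ball zero    = + 0 ∷ []
ball (suc N) = + suc N ∷ -[1+ N ] ∷ ball N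

module Pentagonal (d : ℕ) where

  c : ℕ
  c = suc d

  -q^c : Series
  -q^c = negS (monomial c)

  -- Multiplication by f^k for f = -q^c. As an operator it turns products of powers into
  -- compositions (`S-+`) and passes through convolutions (`⊛-Sʳ`).
  S : ℕ → Series → Series
  S zero    g = g
  S (suc k) g = negS (shift c (S k g))

  S-+ : ∀ k l g → S (k ℕ.+ l) g ≡ S k (S l g)
  S-+ zero    l g = refl
  S-+ (suc k) l g = cong (negS ∘ shift c) (S-+ k l g)

  S-cong : ∀ k {g h} → g ≋ h → S k g ≋ S k h
  S-cong zero    g≋h   = g≋h
  S-cong (suc k) g≋h n = cong -_ (shift-cong c (S-cong k g≋h) n)

  S-⊖ : ∀ k g h → S k (g ⊖ h) ≋ S k g ⊖ S k h
  S-⊖ zero    g h n = refl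
  S-⊖ (suc k) g h n = trans
    (cong -_ (trans (shift-cong c (S-⊖ k g h) n) (shift-⊖ c (S k g) (S k h) n)))
    (lemma (shift c (S k g) n) (shift c (S k h) n))
    where
    lemma : ∀ a b → - (a - b) ≡ - a - - b
    lemma = solve-∀

  S-sgn : ∀ k g n → S k g n ≡ sgn k * shift (k ℕ.* c) g n
  S-sgn zero    g n = sym (ℤₚ.*-identityˡ _)
  S-sgn (suc k) g n = begin
    - shift c (S k g) n                      ≡⟨ cong -_ (shift-cong c (S-sgn k g) n) ⟩
    - shift c (λ i → sgn k * h i) n          ≡⟨ cong -_ (shift-scale c (sgn k) h n) ⟩
    - (sgn k * shift c h n)                  ≡⟨ ℤₚ.neg-distribˡ-* (sgn k) _ ⟩
    - sgn k * shift c h n                    ≡⟨ cong (λ s → - sgn k * s n) (sym (shift-+ c (k ℕ.* c) g)) ⟩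
    - sgn k * shift (c ℕ.+ k ℕ.* c) g n      ∎
    where
    open ≡-Reasoning
    h : Series
    h = shift (k ℕ.* c) g
    shift-scale : ∀ m a h → shift m (λ i → a * h i) ≋ (λ i → a * shift m h i)
    shift-scale zero    a h n       = refl
    shift-scale (suc m) a h zero    = sym (ℤₚ.*-zeroʳ a)
    shift-scale (suc m) a h (suc n) = shift-scale m a h n

  -- The order kc of f^k is at least k because c ≥ 1.
  S-< : ∀ k g {n} → n ℕ.< k → S k g n ≡ 0ℤ
  S-< k g {n} n<k = trans (S-sgn k g n)
    (trans (cong (sgn k *_) (shift-< (k ℕ.* c) g (ℕₚ.<-≤-trans n<k (ℕₚ.m≤m*n k c)))) (ℤₚ.*-zeroʳ (sgn k)))

  S-one : ∀ k n → S k one n ≡ sgn k * monomial (k ℕ.* c) n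
  S-one k n = trans (S-sgn k one n) (cong (sgn k *_) (shift-one (k ℕ.* c) n))

  ⊛-Sʳ : ∀ k g h → g ⊛ S k h ≋ S k (g ⊛ h)
  ⊛-Sʳ zero    g h n = refl
  ⊛-Sʳ (suc k) g h n = trans (⊛-negSʳ g (shift c (S k h)) n)
    (cong -_ (trans (⊛-shiftʳ c g (S k h) n) (shift-cong c (⊛-Sʳ k g h) n)))

  powS≋S : ∀ k → powS -q^c k ≋ S k one
  powS≋S zero    n = refl
  powS≋S (suc k) n = begin
    (-q^c ⊛ powS -q^c k) n   ≡⟨ ⊛-congʳ -q^c (powS≋S k) n ⟩
    (-q^c ⊛ S k one) n       ≡⟨ ⊛-Sʳ k -q^c one n ⟩
    S k (-q^c ⊛ one) n       ≡⟨ S-cong k (⊛-oneʳ -q^c) n ⟩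
    S k -q^c n               ≡⟨ S-cong k (λ i → cong -_ (sym (shift-one c i))) n ⟩
    S k (S 1 one) n          ≡⟨ cong (λ g → g n) (sym (S-+ k 1 one)) ⟩
    S (k ℕ.+ 1) one n        ≡⟨ cong (λ j → S j one n) (ℕₚ.+-comm k 1) ⟩
    S (suc k) one n          ∎
    where open ≡-Reasoning

  -- P s j = ∏ (1 − f^i) over s < i ≤ s + j, where f = −q^c
  P : ℕ → ℕ → Series
  P s zero    = one
  P s (suc j) = P s j ⊖ S (suc (s ℕ.+ j)) (P s j)

  partialE≋P : ∀ N → partialE -q^c N ≋ P 0 N
  partialE≋P zero    n = refl
  partialE≋P (suc N) n = begin
    (g ⊛ (one ⊖ powS -q^c (suc N))) n            ≡⟨ ⊛-⊖ʳ g one (powS -q^c (suc N)) n ⟩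
    (g ⊛ one) n - (g ⊛ powS -q^c (suc N)) n      ≡⟨ cong₂ _-_ (⊛-oneʳ g n) (⊛-congʳ g (powS≋S (suc N)) n) ⟩
    g n - (g ⊛ S (suc N) one) n                  ≡⟨ cong (_-_ (g n)) (⊛-Sʳ (suc N) g one n) ⟩
    g n - S (suc N) (g ⊛ one) n                  ≡⟨ cong (_-_ (g n)) (S-cong (suc N) (⊛-oneʳ g) n) ⟩
    g n - S (suc N) g n                          ≡⟨ cong₂ _-_ (partialE≋P N n) (S-cong (suc N) (partialE≋P N) n) ⟩
    P 0 (suc N) n                                ∎
    where
    open ≡-Reasoning
    g : Series
    g = partialE -q^c N

  -- The recursion of `P` appends the last factor. The first one, 1 - f^(s+1), can be taken out
  -- instead because the powers of f commute; `G-step` uses this to recognise `U (suc s) j`.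
  P-front : ∀ s j → P s (suc j) ≋ P (suc s) j ⊖ S (suc s) (P (suc s) j)
  P-front s zero    n = cong (λ k → one n - S (suc k) one n) (ℕₚ.+-identityʳ s)
  P-front s (suc j) n = begin
    P s (suc j) n - S (suc (s ℕ.+ suc j)) (P s (suc j)) n
      ≡⟨ cong₂ (λ x k → x - S (suc k) (P s (suc j)) n) (P-front s j n) (ℕₚ.+-suc s j) ⟩
    (g n - S a g n) - S b (P s (suc j)) n
      ≡⟨ cong (_-_ (g n - S a g n)) (trans (S-cong b (P-front s j) n) (S-⊖ b g (S a g) n)) ⟩
    (g n - S a g n) - (S b g n - S b (S a g) n)
      ≡⟨ cong (λ h → (g n - S a g n) - (S b g n - h n)) S-comm ⟩
    (g n - S a g n) - (S b g n - S a (S b g) n)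
      ≡⟨ lemma (g n) (S a g n) (S b g n) (S a (S b g) n) ⟩
    (g n - S b g n) - (S a g n - S a (S b g) n)
      ≡⟨ cong (_-_ (g n - S b g n)) (sym (S-⊖ a g (S b g) n)) ⟩
    (g n - S b g n) - S a (g ⊖ S b g) n ∎
    where
    open ≡-Reasoning
    a b : ℕ
    a = suc s
    b = suc (suc s ℕ.+ j)
    g : Series
    g = P (suc s) j
    S-comm : S b (S a g) ≡ S a (S b g)
    S-comm = trans (sym (S-+ b a g)) (trans (cong (λ k → S k g) (ℕₚ.+-comm b a)) (S-+ a b g))
    lemma : ∀ w x y z → (w - x) - (y - z) ≡ (w - y) - (x - z)
    lemma = solve-∀

  -- With N = s + j this is sN + s(s+1)/2, and `T s j` is the unsigned summand (f)_N/(f)_s f^(sN +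
  -- s(s+1)/2) of Shanks' sum.
  e : ℕ → ℕ → ℕ
  e s j = s ℕ.* (s ℕ.+ j) ℕ.+ tri s

  T : ℕ → ℕ → Series
  T s j = S (e s j) (P s j)

  -- G s j = ∑ (−1)^i T (s + i) (j − i) over 0 ≤ i ≤ j; in particular G 0 N is the right side of
  -- Shanks' identity  ∑_{|k| ≤ N} (−1)^k f^{k(3k−1)/2} = ∑_{0 ≤ s ≤ N} (−1)^s (f)_N/(f)_s f^{sN + s(s+1)/2}.
  G : ℕ → ℕ → Series
  G s zero    = T s zero
  G s (suc j) = T s (suc j) ⊖ G (suc s) j

  -- The telescoping quantity: the factor 1 - f^s extends the product `P s j` down to s ≤ i ≤ s + j,
  -- and this factor is zero for s = 0.
  U : ℕ → ℕ → Series
  U s j = S (e s j) (P s j ⊖ S s (P s j))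

  pair : ℕ → Series
  pair N n = S (pent (+ N)) one n + S (pent (- (+ N))) one n

  -- Raising j by one multiplies the summand by f^s (1 - f^(s+j+1)), and f^s (1 - f^(s+j+1)) - 1 =
  -- -(1 - f^s) - f^(2s+j+1).
  T-step : ∀ s j n → T s (suc j) n - T s j n ≡ - U s j n - S (e s j ℕ.+ (s ℕ.+ suc (s ℕ.+ j))) (P s j) n
  T-step s j n = begin
    S (e s (suc j)) (p ⊖ S b p) n - S a p n
      ≡⟨ cong (λ k → S k (p ⊖ S b p) n - S a p n) e-suc ⟩
    S (a ℕ.+ s) (p ⊖ S b p) n - S a p n
      ≡⟨ cong (_- S a p n) (S-⊖ (a ℕ.+ s) p (S b p) n) ⟩
    S (a ℕ.+ s) p n - S (a ℕ.+ s) (S b p) n - S a p n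
      ≡⟨ cong₂ (λ g h → g n - h n - S a p n) (S-+ a s p)
           (trans (sym (S-+ (a ℕ.+ s) b p)) (cong (λ k → S k p) (ℕₚ.+-assoc a s b))) ⟩
    S a (S s p) n - S (a ℕ.+ (s ℕ.+ b)) p n - S a p n
      ≡⟨ lemma (S a (S s p) n) (S (a ℕ.+ (s ℕ.+ b)) p n) (S a p n) ⟩
    - (S a p n - S a (S s p) n) - S (a ℕ.+ (s ℕ.+ b)) p n
      ≡⟨ cong (λ x → - x - S (a ℕ.+ (s ℕ.+ b)) p n) (sym (S-⊖ a p (S s p) n)) ⟩
    - U s j n - S (a ℕ.+ (s ℕ.+ b)) p n ∎
    where
    open ≡-Reasoning
    p : Series
    p = P s j
    a b : ℕ
    a = e s j
    b = suc (s ℕ.+ j)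
    e-suc : e s (suc j) ≡ a ℕ.+ s
    e-suc = e-suc′ s j (tri s)
      where
      e-suc′ : ∀ s j t → s ℕ.* (s ℕ.+ suc j) ℕ.+ t ≡ s ℕ.* (s ℕ.+ j) ℕ.+ t ℕ.+ s
      e-suc′ = solveℕ-∀
    lemma : ∀ x y z → x - y - z ≡ - (z - x) - y
    lemma = solve-∀

  -- The differences T s (j+1) − T s j telescope through U.
  G-step : ∀ s j n → G s (suc j) n - G s j n ≡ - U s j n + sgn (suc j) * pair (suc (s ℕ.+ j)) n
  G-step s zero n = begin
    T s 1 n - T (suc s) 0 n - T s 0 n
      ≡⟨ lemma (T s 1 n) (T (suc s) 0 n) (T s 0 n) ⟩
    (T s 1 n - T s 0 n) - T (suc s) 0 n
      ≡⟨ cong (_- T (suc s) 0 n) (T-step s 0 n) ⟩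
    - U s 0 n - S (e s 0 ℕ.+ (s ℕ.+ suc (s ℕ.+ 0))) one n - S (e (suc s) 0) one n
      -- At j = 0 the two remaining exponents, (s+1)² + s(s+1)/2 and (s+1)² + (s+1)(s+2)/2, are
      -- pentagonal: these are the new terms for k = ±(s + 1).
      ≡⟨ cong₂ (λ k l → - U s 0 n - S k one n - S l one n) exp₁ exp₂ ⟩
    - U s 0 n - S (pent (+ suc (s ℕ.+ 0))) one n - S (pent -[1+ s ℕ.+ 0 ]) one n
      ≡⟨ lemma′ (- U s 0 n) (S (pent (+ suc (s ℕ.+ 0))) one n) (S (pent -[1+ s ℕ.+ 0 ]) one n) ⟩
    - U s 0 n + -1ℤ * pair (suc (s ℕ.+ 0)) n ∎
    where
    open ≡-Reasoning
    lemma : ∀ x y z → x - y - z ≡ (x - z) - y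
    lemma = solve-∀
    lemma′ : ∀ x y z → x - y - z ≡ x + -1ℤ * (y + z)
    lemma′ = solve-∀
    exp₁ : e s 0 ℕ.+ (s ℕ.+ suc (s ℕ.+ 0)) ≡ pent (+ suc (s ℕ.+ 0))
    exp₁ rewrite ℕₚ.+-identityʳ s = exp₁′ s (tri s)
      where
      exp₁′ : ∀ s t → s ℕ.* s ℕ.+ t ℕ.+ (s ℕ.+ suc s) ≡ suc s ℕ.* suc s ℕ.+ t
      exp₁′ = solveℕ-∀
    exp₂ : e (suc s) 0 ≡ pent -[1+ s ℕ.+ 0 ]
    exp₂ rewrite ℕₚ.+-identityʳ s = refl
  G-step s (suc j) n = begin
    T s (2 ℕ.+ j) n - G (suc s) (suc j) n - (T s (suc j) n - G (suc s) j n)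
      ≡⟨ lemma (T s (2 ℕ.+ j) n) (G (suc s) (suc j) n) (T s (suc j) n) (G (suc s) j n) ⟩
    (T s (2 ℕ.+ j) n - T s (suc j) n) - (G (suc s) (suc j) n - G (suc s) j n)
      ≡⟨ cong₂ _-_ (T-step s (suc j) n) (G-step (suc s) j n) ⟩
    - U s (suc j) n - S k (P s (suc j)) n - (- U (suc s) j n + sgn (suc j) * pair (suc (suc s ℕ.+ j)) n)
      -- By `P-front` the last term left by `T-step` is `U (suc s) j`; it cancels against the one in
      -- the induction hypothesis.
      ≡⟨ cong₂ (λ x N → - U s (suc j) n - x - (- U (suc s) j n + sgn (suc j) * pair (suc N) n))
           next-U (sym (ℕₚ.+-suc s j)) ⟩
    - U s (suc j) n - U (suc s) j n - (- U (suc s) j n + sgn (suc j) * pair (suc (s ℕ.+ suc j)) n)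
      ≡⟨ lemma′ (U s (suc j) n) (U (suc s) j n) (sgn (suc j)) (pair (suc (s ℕ.+ suc j)) n) ⟩
    - U s (suc j) n + sgn (2 ℕ.+ j) * pair (suc (s ℕ.+ suc j)) n ∎
    where
    open ≡-Reasoning
    k : ℕ
    k = e s (suc j) ℕ.+ (s ℕ.+ suc (s ℕ.+ suc j))
    k≡e : k ≡ e (suc s) j
    k≡e = lem s j (tri s)
      where
      lem : ∀ s j t → s ℕ.* (s ℕ.+ suc j) ℕ.+ t ℕ.+ (s ℕ.+ suc (s ℕ.+ suc j)) ≡ suc s ℕ.* (suc s ℕ.+ j) ℕ.+ (suc s ℕ.+ t)
      lem = solveℕ-∀
    next-U : S k (P s (suc j)) n ≡ U (suc s) j n
    next-U = trans (cong (λ i → S i (P s (suc j)) n) k≡e) (S-cong (e (suc s) j) (P-front s j) n)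
    lemma : ∀ w x y z → w - x - (y - z) ≡ (w - y) - (x - z)
    lemma = solve-∀
    lemma′ : ∀ u v a p → - u - v - (- v + a * p) ≡ - u + - a * p
    lemma′ = solve-∀

  G-pent : ∀ N n → G 0 N n ≡ ∑ (ball N) (λ k → sgn ∣ k ∣ * S (pent k) one n)
  G-pent zero n = lemma (one n)
    where
    lemma : ∀ x → x ≡ 1ℤ * x + 0ℤ
    lemma = solve-∀
  G-pent (suc N) n = begin
    G 0 (suc N) n                                           ≡⟨ lemma (G 0 (suc N) n) (G 0 N n) ⟩
    (G 0 (suc N) n - G 0 N n) + G 0 N n                     ≡⟨ cong₂ _+_ (G-step 0 N n) (G-pent N n) ⟩
    -- The factor 1 - f^0 makes `U 0 N` zero, so only the pair of pentagonal terms is added.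
    - U 0 N n + sgn (suc N) * (a + b) + r                   ≡⟨ cong (λ x → - x + sgn (suc N) * (a + b) + r) (ℤₚ.+-inverseʳ (P 0 N n)) ⟩
    - 0ℤ + sgn (suc N) * (a + b) + r                        ≡⟨ lemma′ (sgn (suc N)) a b r ⟩
    sgn (suc N) * a + (sgn (suc N) * b + r)                 ∎
    where
    open ≡-Reasoning
    a b r : ℤ
    a = S (pent (+ suc N)) one n
    b = S (pent -[1+ N ]) one n
    r = ∑ (ball N) (λ k → sgn ∣ k ∣ * S (pent k) one n)
    lemma : ∀ x y → x ≡ (x - y) + y
    lemma = solve-∀
    lemma′ : ∀ g a b r → - 0ℤ + g * (a + b) + r ≡ g * a + (g * b + r)
    lemma′ = solve-∀

  -- The exponent of f, (s+1)(s+1+j) + (s+1)(s+2)/2, exceeds s + 1 + j.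
  T-vanish : ∀ s j {n} → n ℕ.≤ suc s ℕ.+ j → T (suc s) j n ≡ 0ℤ
  T-vanish s j n≤ = S-< (e (suc s) j) (P (suc s) j)
    (ℕₚ.≤-<-trans n≤ (ℕₚ.≤-<-trans (ℕₚ.m≤m+n (suc s ℕ.+ j) (s ℕ.* (suc s ℕ.+ j))) (ℕₚ.m<m+n _ z<s)))

  G-vanish : ∀ s j {n} → n ℕ.≤ suc s ℕ.+ j → G (suc s) j n ≡ 0ℤ
  G-vanish s zero    n≤ = T-vanish s zero n≤
  G-vanish s (suc j) n≤ = cong₂ _-_ (T-vanish s (suc j) n≤)
    (G-vanish (suc s) j (ℕₚ.≤-trans n≤ (ℕₚ.≤-reflexive (cong suc (ℕₚ.+-suc s j)))))

  -- In degrees up to N only the summand s = 0 of the alternating sum survives, and it is the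
  -- product itself.
  G≡P : ∀ N {n} → n ℕ.≤ N → G 0 N n ≡ P 0 N n
  G≡P zero    n≤N = refl
  G≡P (suc N) {n} n≤N = trans (cong (_-_ (P 0 (suc N) n)) (G-vanish 0 N n≤N)) (ℤₚ.+-identityʳ _)

  -- The factors of index above n are 1 + O(q^(n+1)), so the truncation that `Esub` makes at n may
  -- be moved to any larger bound.
  P-stable : ∀ n j → P 0 (j ℕ.+ n) n ≡ P 0 n n
  P-stable n zero    = refl
  P-stable n (suc j) = trans
    (cong (_-_ (P 0 (j ℕ.+ n) n)) (S-< (suc (j ℕ.+ n)) (P 0 (j ℕ.+ n)) (s≤s (ℕₚ.m≤n+m n j))))
    (trans (ℤₚ.+-identityʳ _) (P-stable n j))

  -- N is left free above n so that one list `ball m` serves for all coefficients of both factors in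
  -- `E-product`.
  pentagonal : ∀ {n N} → n ℕ.≤ N →
    Esub -q^c n ≡ ∑ (ball N) (λ k → sgn ∣ k ∣ * sgn (pent k) * monomial (pent k ℕ.* c) n)
  pentagonal {n} {N} n≤N = begin
    partialE -q^c n n      ≡⟨ partialE≋P n n ⟩
    P 0 n n                ≡⟨ sym (P-stable n (N ℕ.∸ n)) ⟩
    P 0 (N ℕ.∸ n ℕ.+ n) n  ≡⟨ cong (λ M → P 0 M n) (ℕₚ.m∸n+n≡m n≤N) ⟩
    P 0 N n                ≡⟨ sym (G≡P N n≤N) ⟩
    G 0 N n                ≡⟨ G-pent N n ⟩
    ∑ (ball N) (λ k → sgn ∣ k ∣ * S (pent k) one n)
      ≡⟨ ∑-cong (ball N) (λ k → trans (cong (sgn ∣ k ∣ *_) (S-one (pent k) n)) (sym (ℤₚ.*-assoc (sgn ∣ k ∣) _ _))) ⟩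
    ∑ (ball N) (λ k → sgn ∣ k ∣ * sgn (pent k) * monomial (pent k ℕ.* c) n) ∎
    where open ≡-Reasoning

-- Enumerated types and sums over them

record Enum (A : Set) : Set where
  field
    elems    : List A
    unique   : Unique elems
    complete : ∀ a → a ∈ elems

open Enum

∑ᴱ : {A : Set} → Enum A → (A → ℤ) → ℤ
∑ᴱ e = ∑ (elems e)

card : {A : Set} → Enum A → ℤ
card e = ∑ᴱ e (λ _ → 1ℤ)

-- Duplicate-free lists with the same members are permutations of each other. Sums and cardinalities
-- thus depend only on the type and can be carried along bijections.
∑ᴱ-unique : {A : Set} (d e : Enum A) (w : A → ℤ) → ∑ᴱ d w ≡ ∑ᴱ e w
∑ᴱ-unique d e w = ∑-↭ w (∼bag⇒↭ (unique∧set⇒bag (unique d) (unique e)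
  (mk⇔ (λ _ → complete e _) (λ _ → complete d _))))

Enum-↔ : {A B : Set} → A ↔ B → Enum A → Enum B
Enum-↔ i e = record
  { elems    = map (to i) (elems e)
  ; unique   = Unique.map⁺ (λ {x} {y} eq → trans (sym (strictlyInverseʳ i x)) (trans (cong (from i) eq) (strictlyInverseʳ i y))) (unique e)
  ; complete = λ b → subst (_∈ map (to i) (elems e)) (strictlyInverseˡ i b) (∈-map⁺ (to i) (complete e (from i b)))
  }

∑ᴱ-↔ : {A B : Set} (i : A ↔ B) (d : Enum A) (e : Enum B) (w : B → ℤ) → ∑ᴱ e w ≡ ∑ᴱ d (w ∘ to i)
∑ᴱ-↔ i d e w = trans (∑ᴱ-unique e (Enum-↔ i d) w) (∑-map (to i) w (elems d))

∑ᴱ-one : {A : Set} (e : Enum A) {w : A → ℤ} → (∀ a → w a ≡ 1ℤ) → ∑ᴱ e w ≡ card e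
∑ᴱ-one e w≡1 = ∑-cong (elems e) w≡1

∑ᴱ-minus-one : {A : Set} (e : Enum A) {w : A → ℤ} → (∀ a → w a ≡ -1ℤ) → ∑ᴱ e w ≡ - card e
∑ᴱ-minus-one e w≡-1 = trans (∑-cong (elems e) w≡-1)
  (trans (∑-*ˡ -1ℤ (λ _ → 1ℤ) (elems e)) (ℤₚ.-1*i≡-i (card e)))

Enum-⊎ : {A B : Set} → Enum A → Enum B → Enum (A ⊎ B)
Enum-⊎ {A} {B} d e = record
  { elems    = map inj₁ (elems d) ++ map inj₂ (elems e)
  ; unique   = Unique.++⁺ (Unique.map⁺ inj₁-injective (unique d)) (Unique.map⁺ inj₂-injective (unique e)) disjoint
  ; complete = λ { (inj₁ a) → ∈-++⁺ˡ (∈-map⁺ inj₁ (complete d a))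
                 ; (inj₂ b) → ∈-++⁺ʳ _ (∈-map⁺ inj₂ (complete e b)) }
  }
  where
  disjoint : ∀ {x : A ⊎ B} → ¬ (x ∈ map inj₁ (elems d) × x ∈ map inj₂ (elems e))
  disjoint (p , q) with ∈-map⁻ inj₁ p | ∈-map⁻ inj₂ q
  ... | _ , _ , refl | _ , _ , ()

∑ᴱ-⊎ : {A B C : Set} (i : (A ⊎ B) ↔ C) (d : Enum A) (e : Enum B) (f : Enum C) (w : C → ℤ) →
  ∑ᴱ f w ≡ ∑ᴱ d (w ∘ to i ∘ inj₁) + ∑ᴱ e (w ∘ to i ∘ inj₂)
∑ᴱ-⊎ i d e f w = begin
  ∑ᴱ f w                                                   ≡⟨ ∑ᴱ-↔ i (Enum-⊎ d e) f w ⟩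
  ∑ (map inj₁ (elems d) ++ map inj₂ (elems e)) (w ∘ to i)  ≡⟨ ∑-++ (w ∘ to i) (map inj₁ (elems d)) _ ⟩
  ∑ (map inj₁ (elems d)) (w ∘ to i) + ∑ (map inj₂ (elems e)) (w ∘ to i)
    ≡⟨ cong₂ _+_ (∑-map inj₁ (w ∘ to i) (elems d)) (∑-map inj₂ (w ∘ to i) (elems e)) ⟩
  ∑ᴱ d (w ∘ to i ∘ inj₁) + ∑ᴱ e (w ∘ to i ∘ inj₂)          ∎
  where open ≡-Reasoning

lefts : {A B : Set} → List (A ⊎ B) → List A
lefts []            = []
lefts (inj₁ a ∷ xs) = a ∷ lefts xs
lefts (inj₂ b ∷ xs) = lefts xs

∈-lefts⁺ : {A B : Set} {a : A} {xs : List (A ⊎ B)} → inj₁ a ∈ xs → a ∈ lefts xs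
∈-lefts⁺ {xs = inj₁ _ ∷ xs} (here refl) = here refl
∈-lefts⁺ {xs = inj₁ _ ∷ xs} (there p)   = there (∈-lefts⁺ p)
∈-lefts⁺ {xs = inj₂ _ ∷ xs} (there p)   = ∈-lefts⁺ p

∈-lefts⁻ : {A B : Set} {a : A} (xs : List (A ⊎ B)) → a ∈ lefts xs → inj₁ a ∈ xs
∈-lefts⁻ (inj₁ _ ∷ xs) (here refl) = here refl
∈-lefts⁻ (inj₁ _ ∷ xs) (there p)   = there (∈-lefts⁻ xs p)
∈-lefts⁻ (inj₂ _ ∷ xs) p           = there (∈-lefts⁻ xs p)

lefts-unique : {A B : Set} {xs : List (A ⊎ B)} → Unique xs → Unique (lefts xs)
lefts-unique {xs = []}          []       = []
lefts-unique {xs = inj₁ a ∷ xs} (a∉ ∷ u) =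
  All.tabulate (λ b∈ a≡b → All.lookup a∉ (∈-lefts⁻ xs b∈) (cong inj₁ a≡b)) ∷ lefts-unique u
lefts-unique {xs = inj₂ b ∷ xs} (_ ∷ u)  = lefts-unique u

-- Lets all residue classes inherit finiteness from the solution sets of `f₁`, `f₂` and `κ`, the
-- only ones for which a search box is given.
Enum-left : {A B : Set} → Enum (A ⊎ B) → Enum A
Enum-left e = record
  { elems    = lefts (elems e)
  ; unique   = lefts-unique (unique e)
  ; complete = λ a → ∈-lefts⁺ (complete e (inj₁ a))
  }

Enum-right : {A B : Set} → Enum (A ⊎ B) → Enum B
Enum-right = Enum-left ∘ Enum-↔ (mk↔ₛ′ swap swap swap-swap swap-swap)
  where
  swap-swap : {A B : Set} (x : A ⊎ B) → swap (swap x) ≡ x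
  swap-swap (inj₁ _) = refl
  swap-swap (inj₂ _) = refl

module _ {A : Set} {D : A → Set} (D? : Decidable D) where

  collect : List A → List (Σ A D)
  collect []       = []
  collect (x ∷ xs) with D? x
  ... | yes d = (x , d) ∷ collect xs
  ... | no  _ = collect xs

  -- Meant for f = w times an indicator of D; in `E-product` the indicator is a coefficient of a
  -- monomial.
  ∑-collect : (w f : A → ℤ) → (∀ {x} → D x → f x ≡ w x) → (∀ {x} → ¬ D x → f x ≡ 0ℤ) →
    ∀ xs → ∑ (collect xs) (w ∘ proj₁) ≡ ∑ xs f
  ∑-collect w f on off []       = refl
  ∑-collect w f on off (x ∷ xs) with D? x
  ... | yes d = cong₂ _+_ (sym (on d)) (∑-collect w f on off xs)
  ... | no ¬d = trans (∑-collect w f on off xs)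
    (trans (sym (ℤₚ.+-identityˡ _)) (cong (λ z → z + ∑ xs f) (sym (off ¬d))))

  length-filter : ∀ xs → + length (filter D? xs) ≡ ∑ (collect xs) (λ _ → 1ℤ)
  length-filter []       = refl
  length-filter (x ∷ xs) with D? x
  ... | yes d = cong (_+_ 1ℤ) (length-filter xs)
  ... | no ¬d = length-filter xs

  proj₁-collect : ∀ xs {p} → p ∈ collect xs → proj₁ p ∈ xs
  proj₁-collect (x ∷ xs) p∈ with D? x
  proj₁-collect (x ∷ xs) (here refl) | yes d = here refl
  proj₁-collect (x ∷ xs) (there p∈)  | yes d = there (proj₁-collect xs p∈)
  proj₁-collect (x ∷ xs) p∈          | no ¬d = there (proj₁-collect xs p∈)

  collect-unique : ∀ {xs} → Unique xs → Unique (collect xs)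
  collect-unique {[]}     []       = []
  collect-unique {x ∷ xs} (x∉ ∷ u) with D? x
  ... | yes d = All.tabulate (λ p∈ eq → All.lookup x∉ (proj₁-collect xs p∈) (cong proj₁ eq)) ∷ collect-unique u
  ... | no ¬d = collect-unique u

  ∈-collect : (∀ {x} (d d′ : D x) → d ≡ d′) → ∀ {xs x} (d : D x) → x ∈ xs → (x , d) ∈ collect xs
  ∈-collect irr {y ∷ xs} d x∈ with D? y
  ∈-collect irr {y ∷ xs} d (here refl) | yes d′ = here (cong (y ,_) (irr d d′))
  ∈-collect irr {y ∷ xs} d (there x∈)  | yes d′ = there (∈-collect irr d x∈)
  ∈-collect irr {y ∷ xs} d (here refl) | no ¬d  = contradiction d ¬d
  ∈-collect irr {y ∷ xs} d (there x∈)  | no ¬d  = ∈-collect irr d x∈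

  Enum-collect : (∀ {x} (d d′ : D x) → d ≡ d′) → ∀ {xs} → Unique xs → (∀ {x} → D x → x ∈ xs) → Enum (Σ A D)
  Enum-collect irr {xs} u all = record
    { elems    = collect xs
    ; unique   = collect-unique u
    ; complete = λ { (x , d) → ∈-collect irr d (all d) }
    }

-- Solution sets of an equation q = n and their decompositions

Sol : {I : Set} → (I → ℤ) → ℤ → Set
Sol {I} q n = Σ I (λ i → q i ≡ n)

Sol-≡ : {I : Set} {q : I → ℤ} {n : ℤ} {s t : Sol q n} → proj₁ s ≡ proj₁ t → s ≡ t
Sol-≡ {s = i , refl} {t = .i , refl} refl = refl

Sol-↔ : {I J : Set} {q : I → ℤ} {r : J → ℤ} (φ : I ↔ J) → (∀ i → r (to φ i) ≡ q i) →
  ∀ {n} → Sol q n ↔ Sol r n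
Sol-↔ {q = q} {r} φ r∘φ≡q = mk↔ₛ′
  (λ { (i , eq) → to φ i , trans (r∘φ≡q i) eq })
  (λ { (j , eq) → from φ j , trans (sym (r∘φ≡q (from φ j))) (trans (cong r (strictlyInverseˡ φ j)) eq) })
  (λ { (j , eq) → Sol-≡ (strictlyInverseˡ φ j) })
  (λ { (i , eq) → Sol-≡ (strictlyInverseʳ φ i) })

Sol-⊎ : {I J K : Set} {r : K → ℤ} (φ : (I ⊎ J) ↔ K) →
  ∀ {n} → (Sol (r ∘ to φ ∘ inj₁) n ⊎ Sol (r ∘ to φ ∘ inj₂) n) ↔ Sol r n
Sol-⊎ {r = r} φ {n} = mk↔ₛ′
    [ (λ { (i , eq) → to φ (inj₁ i) , eq }) , (λ { (j , eq) → to φ (inj₂ j) , eq }) ]′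
    (λ { (k , eq) → classify (from φ k) (trans (cong r (strictlyInverseˡ φ k)) eq) })
    (λ { (k , eq) → Sol-≡ (trans (to-classify (from φ k) _) (strictlyInverseˡ φ k)) })
    (λ { (inj₁ (i , eq)) → classify-inj₁ (strictlyInverseʳ φ (inj₁ i))
       ; (inj₂ (j , eq)) → classify-inj₂ (strictlyInverseʳ φ (inj₂ j)) })
  where
  L R : Set
  L = Sol (r ∘ to φ ∘ inj₁) n
  R = Sol (r ∘ to φ ∘ inj₂) n
  -- The equation is a separate argument because its type must reduce along with the case
  -- distinction on x.
  classify : ∀ x → r (to φ x) ≡ n → L ⊎ R
  classify (inj₁ i) eq = inj₁ (i , eq)
  classify (inj₂ j) eq = inj₂ (j , eq)
  to-classify : ∀ x eq → proj₁ ([ (λ { (i , eq) → to φ (inj₁ i) , eq }) , (λ { (j , eq) → to φ (inj₂ j) , eq }) ]′ (classify x eq)) ≡ to φ x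
  to-classify (inj₁ i) eq = refl
  to-classify (inj₂ j) eq = refl
  classify-inj₁ : ∀ {x i eq eq′} → x ≡ inj₁ i → classify x eq ≡ inj₁ (i , eq′)
  classify-inj₁ refl = cong inj₁ (Sol-≡ refl)
  classify-inj₂ : ∀ {x j eq eq′} → x ≡ inj₂ j → classify x eq ≡ inj₂ (j , eq′)
  classify-inj₂ refl = cong inj₂ (Sol-≡ refl)

-- Residue classes of ℤ² modulo 2 and 3

ℤ² : Set
ℤ² = ℤ × ℤ

bijection : {A B : Set} (f : A → B) → (∀ b → Σ A (λ a → f a ≡ b)) → (∀ {x y} → f x ≡ f y → x ≡ y) → A ↔ B
bijection f section injective = mk↔ₛ′ f (proj₁ ∘ section) (proj₂ ∘ section) (λ a → injective (proj₂ (section (f a))))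

d*i≢r : ∀ d i r .{{_ : ℕ.NonZero r}} → r ℕ.< d → + d * i ≢ + r
d*i≢r d i r r<d eq = ℕ∣.>⇒∤ r<d (ℕ∣.divides ∣ i ∣
  (trans (sym (cong ∣_∣ eq)) (trans (ℤₚ.abs-* (+ d) i) (ℕₚ.*-comm d ∣ i ∣))))

halves : (ℤ² ⊎ ℤ²) ↔ ℤ²
halves = bijection f section injective
  where
  f : ℤ² ⊎ ℤ² → ℤ²
  f (inj₁ (c , y)) = + 2 * c , y
  f (inj₂ (c , y)) = + 2 * c + + 1 , y
  section : ∀ p → Σ (ℤ² ⊎ ℤ²) (λ s → f s ≡ p)
  section (a , y) with a %ℕ 2 | n%ℕd<d a 2 | a≡a%ℕn+[a/ℕn]*n a 2
  ... | 0 | _ | eq = inj₁ (a /ℕ 2 , y) , cong (_, y) (trans (lemma (a /ℕ 2)) (sym eq))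
    where
    lemma : ∀ c → + 2 * c ≡ + 0 + c * + 2
    lemma = solve-∀
  ... | 1 | _ | eq = inj₂ (a /ℕ 2 , y) , cong (_, y) (trans (lemma (a /ℕ 2)) (sym eq))
    where
    lemma : ∀ c → + 2 * c + + 1 ≡ + 1 + c * + 2
    lemma = solve-∀
  ... | suc (suc _) | s≤s (s≤s ()) | _
  distinct : ∀ c d → + 2 * c ≢ + 2 * d + + 1
  distinct c d eq = d*i≢r 2 (c - d) 1 (s≤s (s≤s z≤n)) (trans (lemma c d) (trans (cong (λ x → x - + 2 * d) eq) (lemma′ d)))
    where
    lemma : ∀ c d → + 2 * (c - d) ≡ + 2 * c - + 2 * d
    lemma = solve-∀
    lemma′ : ∀ d → + 2 * d + + 1 - + 2 * d ≡ + 1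
    lemma′ = solve-∀
  injective : ∀ {s t} → f s ≡ f t → s ≡ t
  injective {inj₁ (c , y)} {inj₁ (d , z)} eq = cong inj₁ (cong₂ _,_
    (ℤₚ.*-cancelˡ-≡ (+ 2) c d (cong proj₁ eq)) (cong proj₂ eq))
  injective {inj₁ (c , y)} {inj₂ (d , z)} eq = ⊥-elim (distinct c d (cong proj₁ eq))
  injective {inj₂ (c , y)} {inj₁ (d , z)} eq = ⊥-elim (distinct d c (sym (cong proj₁ eq)))
  injective {inj₂ (c , y)} {inj₂ (d , z)} eq = cong inj₂ (cong₂ _,_
    (ℤₚ.*-cancelˡ-≡ (+ 2) c d (+-cancelʳ (+ 1) (+ 2 * c) (+ 2 * d) (cong proj₁ eq))) (cong proj₂ eq))

-- The class of -1 is written -(3a + 1) rather than 3a + 2, so that x ↦ -x matches it with the class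
-- of 1 at the same a.
thirds : (ℤ² ⊎ (ℤ² ⊎ ℤ²)) ↔ ℤ²
thirds = bijection f section injective
  where
  f : ℤ² ⊎ (ℤ² ⊎ ℤ²) → ℤ²
  f (inj₁ (a , y))        = + 3 * a , y
  f (inj₂ (inj₁ (a , y))) = + 3 * a + + 1 , y
  f (inj₂ (inj₂ (a , y))) = - (+ 3 * a + + 1) , y
  section : ∀ p → Σ (ℤ² ⊎ (ℤ² ⊎ ℤ²)) (λ s → f s ≡ p)
  section (x , y) with x %ℕ 3 | n%ℕd<d x 3 | a≡a%ℕn+[a/ℕn]*n x 3
  ... | 0 | _ | eq = inj₁ (x /ℕ 3 , y) , cong (_, y) (trans (lemma (x /ℕ 3)) (sym eq))
    where
    lemma : ∀ c → + 3 * c ≡ + 0 + c * + 3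
    lemma = solve-∀
  ... | 1 | _ | eq = inj₂ (inj₁ (x /ℕ 3 , y)) , cong (_, y) (trans (lemma (x /ℕ 3)) (sym eq))
    where
    lemma : ∀ c → + 3 * c + + 1 ≡ + 1 + c * + 3
    lemma = solve-∀
  ... | 2 | _ | eq = inj₂ (inj₂ (- (x /ℕ 3) - + 1 , y)) , cong (_, y) (trans (lemma (x /ℕ 3)) (sym eq))
    where
    lemma : ∀ c → - (+ 3 * (- c - + 1) + + 1) ≡ + 2 + c * + 3
    lemma = solve-∀
  ... | suc (suc (suc _)) | s≤s (s≤s (s≤s ())) | _
  distinct₁ : ∀ a b → + 3 * a ≢ + 3 * b + + 1
  distinct₁ a b eq = d*i≢r 3 (a - b) 1 (s≤s (s≤s z≤n)) (trans (lemma a b) (trans (cong (λ x → x - + 3 * b) eq) (lemma′ b)))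
    where
    lemma : ∀ a b → + 3 * (a - b) ≡ + 3 * a - + 3 * b
    lemma = solve-∀
    lemma′ : ∀ b → + 3 * b + + 1 - + 3 * b ≡ + 1
    lemma′ = solve-∀
  distinct₂ : ∀ a b → + 3 * a ≢ - (+ 3 * b + + 1)
  distinct₂ a b eq = distinct₁ (- a) b (trans (lemma a) (trans (cong -_ eq) (ℤₚ.neg-involutive (+ 3 * b + + 1))))
    where
    lemma : ∀ a → + 3 * (- a) ≡ - (+ 3 * a)
    lemma = solve-∀
  distinct₃ : ∀ a b → + 3 * a + + 1 ≢ - (+ 3 * b + + 1)
  distinct₃ a b eq = d*i≢r 3 (- a - b) 2 (s≤s (s≤s (s≤s z≤n)))
    (trans (lemma a b) (trans (cong (λ x → + 1 - x - + 3 * b) eq) (lemma′ b)))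
    where
    lemma : ∀ a b → + 3 * (- a - b) ≡ + 1 - (+ 3 * a + + 1) - + 3 * b
    lemma = solve-∀
    lemma′ : ∀ b → + 1 - - (+ 3 * b + + 1) - + 3 * b ≡ + 2
    lemma′ = solve-∀
  cancel : ∀ a b → + 3 * a + + 1 ≡ + 3 * b + + 1 → a ≡ b
  cancel a b eq = ℤₚ.*-cancelˡ-≡ (+ 3) a b (+-cancelʳ (+ 1) (+ 3 * a) (+ 3 * b) eq)
  injective : ∀ {s t} → f s ≡ f t → s ≡ t
  injective {inj₁ (a , y)} {inj₁ (b , z)} eq = cong inj₁ (cong₂ _,_
    (ℤₚ.*-cancelˡ-≡ (+ 3) a b (cong proj₁ eq)) (cong proj₂ eq))
  injective {inj₁ (a , y)} {inj₂ (inj₁ (b , z))} eq = ⊥-elim (distinct₁ a b (cong proj₁ eq))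
  injective {inj₁ (a , y)} {inj₂ (inj₂ (b , z))} eq = ⊥-elim (distinct₂ a b (cong proj₁ eq))
  injective {inj₂ (inj₁ (a , y))} {inj₁ (b , z)} eq = ⊥-elim (distinct₁ b a (sym (cong proj₁ eq)))
  injective {inj₂ (inj₂ (a , y))} {inj₁ (b , z)} eq = ⊥-elim (distinct₂ b a (sym (cong proj₁ eq)))
  injective {inj₂ (inj₁ (a , y))} {inj₂ (inj₁ (b , z))} eq = cong (inj₂ ∘ inj₁) (cong₂ _,_
    (cancel a b (cong proj₁ eq)) (cong proj₂ eq))
  injective {inj₂ (inj₁ (a , y))} {inj₂ (inj₂ (b , z))} eq = ⊥-elim (distinct₃ a b (cong proj₁ eq))
  injective {inj₂ (inj₂ (a , y))} {inj₂ (inj₁ (b , z))} eq = ⊥-elim (distinct₃ b a (sym (cong proj₁ eq)))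
  injective {inj₂ (inj₂ (a , y))} {inj₂ (inj₂ (b , z))} eq = cong (inj₂ ∘ inj₂) (cong₂ _,_
    (cancel a b (ℤₚ.neg-injective (cong proj₁ eq))) (cong proj₂ eq))

-- Turns the parity of the first coordinate into the parity of the sum of both coordinates.
shear : ℤ² ↔ ℤ²
shear = mk↔ₛ′ (λ { (a , y) → a - y , y }) (λ { (a , y) → a + y , y })
  (λ { (a , y) → cong (_, y) (left a y) }) (λ { (a , y) → cong (_, y) (right a y) })
  where
  left : ∀ a y → a + y - y ≡ a
  left = solve-∀
  right : ∀ a y → a - y + y ≡ a
  right = solve-∀

-- the classes of even and of odd a + y
parity : (ℤ² ⊎ ℤ²) ↔ ℤ²
parity = shear ↔-∘ halves

-- The signs of the pentagonal expansion

-- the sign with which q^{c·pent k} occurs in E(−q^c)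
ε : ℤ → ℤ
ε k = sgn ∣ k ∣ * sgn (pent k)

sgn-+ : ∀ m n → sgn (m ℕ.+ n) ≡ sgn m * sgn n
sgn-+ zero    n = sym (ℤₚ.*-identityˡ (sgn n))
sgn-+ (suc m) n = trans (cong -_ (sgn-+ m n)) (ℤₚ.neg-distribˡ-* (sgn m) (sgn n))

sgn² : ∀ m → sgn m * sgn m ≡ 1ℤ
sgn² zero    = refl
sgn² (suc m) = trans (lemma (sgn m)) (sgn² m)
  where
  lemma : ∀ x → - x * - x ≡ x * x
  lemma = solve-∀

ε² : ∀ k → ε k * ε k ≡ 1ℤ
ε² k = trans (lemma (sgn ∣ k ∣) (sgn (pent k))) (cong₂ _*_ (sgn² ∣ k ∣) (sgn² (pent k)))
  where
  lemma : ∀ x y → x * y * (x * y) ≡ x * x * (y * y)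
  lemma = solve-∀

sgn-odd : ∀ m j → sgn (m ℕ.+ suc (j ℕ.+ j)) ≡ - sgn m
sgn-odd m j = begin
  sgn (m ℕ.+ suc (j ℕ.+ j))   ≡⟨ sgn-+ m (suc (j ℕ.+ j)) ⟩
  sgn m * - sgn (j ℕ.+ j)     ≡⟨ cong (λ x → sgn m * - x) (trans (sgn-+ j j) (sgn² j)) ⟩
  sgn m * -1ℤ                 ≡⟨ lemma (sgn m) ⟩
  - sgn m                     ∎
  where
  open ≡-Reasoning
  lemma : ∀ x → x * -1ℤ ≡ - x
  lemma = solve-∀

ε-flip : ∀ a x y → y ≡ - x → (- - a) * y ≡ - (a * x)
ε-flip a x y refl = lemma a x
  where
  lemma : ∀ a x → (- - a) * - x ≡ - (a * x)
  lemma = solve-∀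

-- The parity of |k| is kept, while pent (k + 2) - pent k = 6k + 5 is odd: it is 6s + 11 for k = s +
-- 1 and -(6s + 13) for k = -(s + 3).
ε-+2 : ∀ k → ε (k + + 2) ≡ - ε k
ε-+2 (+ zero)  = refl
ε-+2 (+ suc s) rewrite ℕₚ.+-comm s 2 = ε-flip (sgn (suc s)) (sgn (pent (+ suc s))) _
  (trans (cong sgn (lemma s (tri s))) (sgn-odd (pent (+ suc s)) (3 ℕ.* s ℕ.+ 5)))
  where
  lemma : ∀ s t → (3 ℕ.+ s) ℕ.* (3 ℕ.+ s) ℕ.+ ((2 ℕ.+ s) ℕ.+ ((1 ℕ.+ s) ℕ.+ t))
    ≡ suc s ℕ.* suc s ℕ.+ t ℕ.+ suc ((3 ℕ.* s ℕ.+ 5) ℕ.+ (3 ℕ.* s ℕ.+ 5))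
  lemma = solveℕ-∀
ε-+2 -[1+ 0 ] = refl
ε-+2 -[1+ 1 ] = refl
ε-+2 -[1+ suc (suc s) ] = trans (sym (ℤₚ.neg-involutive (ε -[1+ s ]))) (cong -_ (sym
  (ε-flip (sgn (suc s)) (sgn (pent -[1+ s ])) _
    (trans (cong sgn (lemma s (tri s))) (sgn-odd (pent -[1+ s ]) (3 ℕ.* s ℕ.+ 6))))))
  where
  lemma : ∀ s t → (3 ℕ.+ s) ℕ.* (3 ℕ.+ s) ℕ.+ ((3 ℕ.+ s) ℕ.+ ((2 ℕ.+ s) ℕ.+ ((1 ℕ.+ s) ℕ.+ t)))
    ≡ suc s ℕ.* suc s ℕ.+ ((1 ℕ.+ s) ℕ.+ t) ℕ.+ suc ((3 ℕ.* s ℕ.+ 6) ℕ.+ (3 ℕ.* s ℕ.+ 6))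
  lemma = solveℕ-∀

ε-+4n : ∀ k n → ε (k + + 4 * + n) ≡ ε k
ε-+4n k zero    = cong ε (ℤₚ.+-identityʳ k)
ε-+4n k (suc n) = begin
  ε (k + + 4 * + suc n)           ≡⟨ cong (λ x → ε (k + + 4 * x)) (ℤₚ.pos-+ 1 n) ⟩
  ε (k + + 4 * (+ 1 + + n))       ≡⟨ cong ε (lemma k (+ n)) ⟩
  ε (k + + 4 * + n + + 2 + + 2)   ≡⟨ ε-+2 (k + + 4 * + n + + 2) ⟩
  - ε (k + + 4 * + n + + 2)       ≡⟨ cong -_ (ε-+2 (k + + 4 * + n)) ⟩
  - - ε (k + + 4 * + n)           ≡⟨ ℤₚ.neg-involutive _ ⟩
  ε (k + + 4 * + n)               ≡⟨ ε-+4n k n ⟩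
  ε k                             ∎
  where
  open ≡-Reasoning
  lemma : ∀ k n → k + + 4 * (+ 1 + n) ≡ k + + 4 * n + + 2 + + 2
  lemma = solve-∀

ε-+4 : ∀ k j → ε (k + + 4 * j) ≡ ε k
ε-+4 k (+ n)    = ε-+4n k n
ε-+4 k -[1+ n ] = trans (sym (ε-+4n (k + + 4 * -[1+ n ]) (suc n))) (cong ε (lemma k (+ suc n)))
  where
  lemma : ∀ k j → k + + 4 * (- j) + + 4 * j ≡ k
  lemma = solve-∀

-- Both sides change sign under n ↦ n + 2, so n = 0 and n = 1 decide.
ε-1-n : ∀ n → ε (+ 1 - + n) ≡ ε (+ n)
ε-1-n 0             = refl
ε-1-n 1             = refl
ε-1-n (suc (suc n)) = begin
  ε (+ 1 - + suc (suc n))             ≡⟨ sym (ℤₚ.neg-involutive _) ⟩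
  - - ε (+ 1 - + suc (suc n))         ≡⟨ cong -_ (sym (ε-+2 (+ 1 - + suc (suc n)))) ⟩
  - ε (+ 1 - (+ suc (suc n)) + + 2)   ≡⟨ cong (λ x → - ε (+ 1 - x + + 2)) (ℤₚ.pos-+ 2 n) ⟩
  - ε (+ 1 - (+ 2 + + n) + + 2)       ≡⟨ cong (-_ ∘ ε) (lemma (+ n)) ⟩
  - ε (+ 1 - + n)                     ≡⟨ cong -_ (ε-1-n n) ⟩
  - ε (+ n)                           ≡⟨ sym (ε-+2 (+ n)) ⟩
  ε (+ n + + 2)                       ≡⟨ cong ε (ℤₚ.+-comm (+ n) (+ 2)) ⟩
  ε (+ suc (suc n))                   ∎
  where
  open ≡-Reasoning
  lemma : ∀ n → + 1 - (+ 2 + n) + + 2 ≡ + 1 - n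
  lemma = solve-∀

ε-1- : ∀ k → ε (+ 1 - k) ≡ ε k
ε-1- (+ n)    = ε-1-n n
ε-1- -[1+ n ] = sym (ε-1-n (suc (suc n)))

-- Pentagonal exponents as squares

tri-double : ∀ s → + 2 * + tri s ≡ + s * (+ s + + 1)
tri-double zero    = refl
tri-double (suc s) = begin
  + 2 * + (suc s ℕ.+ tri s)             ≡⟨ cong (_*_ (+ 2)) (ℤₚ.pos-+ (suc s) (tri s)) ⟩
  + 2 * (+ suc s + + tri s)             ≡⟨ ℤₚ.*-distribˡ-+ (+ 2) (+ suc s) (+ tri s) ⟩
  + 2 * + suc s + + 2 * + tri s         ≡⟨ cong₂ (λ x y → + 2 * x + y) (ℤₚ.pos-+ 1 s) (tri-double s) ⟩
  + 2 * (+ 1 + + s) + + s * (+ s + + 1) ≡⟨ lemma (+ s) ⟩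
  (+ 1 + + s) * (+ 1 + + s + + 1)       ≡⟨ cong (λ x → x * (x + + 1)) (sym (ℤₚ.pos-+ 1 s)) ⟩
  + suc s * (+ suc s + + 1)             ∎
  where
  open ≡-Reasoning
  lemma : ∀ s → + 2 * (+ 1 + s) + s * (s + + 1) ≡ (+ 1 + s) * (+ 1 + s + + 1)
  lemma = solve-∀

pent-square : ∀ k → + 24 * + pent k + + 1 ≡ (+ 6 * k - + 1) * (+ 6 * k - + 1)
pent-square (+ zero)  = refl
pent-square (+ suc s) = begin
  + 24 * + (suc s ℕ.* suc s ℕ.+ tri s) + + 1
    ≡⟨ cong (λ x → + 24 * x + + 1) (trans (ℤₚ.pos-+ (suc s ℕ.* suc s) (tri s)) (cong (λ x → x + + tri s) (ℤₚ.pos-* (suc s) (suc s)))) ⟩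
  + 24 * (+ suc s * + suc s + + tri s) + + 1
    ≡⟨ lemma₁ (+ suc s) (+ tri s) ⟩
  + 24 * (+ suc s * + suc s) + + 12 * (+ 2 * + tri s) + + 1
    ≡⟨ cong₂ (λ x y → + 24 * (x * x) + + 12 * y + + 1) (ℤₚ.pos-+ 1 s) (tri-double s) ⟩
  + 24 * ((+ 1 + + s) * (+ 1 + + s)) + + 12 * (+ s * (+ s + + 1)) + + 1
    ≡⟨ lemma₂ (+ s) ⟩
  (+ 6 * (+ 1 + + s) - + 1) * (+ 6 * (+ 1 + + s) - + 1)
    ≡⟨ cong (λ x → (+ 6 * x - + 1) * (+ 6 * x - + 1)) (sym (ℤₚ.pos-+ 1 s)) ⟩
  (+ 6 * + suc s - + 1) * (+ 6 * + suc s - + 1) ∎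
  where
  open ≡-Reasoning
  lemma₁ : ∀ x t → + 24 * (x * x + t) + + 1 ≡ + 24 * (x * x) + + 12 * (+ 2 * t) + + 1
  lemma₁ = solve-∀
  lemma₂ : ∀ s → + 24 * ((+ 1 + s) * (+ 1 + s)) + + 12 * (s * (s + + 1)) + + 1
    ≡ (+ 6 * (+ 1 + s) - + 1) * (+ 6 * (+ 1 + s) - + 1)
  lemma₂ = solve-∀
pent-square -[1+ s ] = begin
  + 24 * + (suc s ℕ.* suc s ℕ.+ tri (suc s)) + + 1
    ≡⟨ cong (λ x → + 24 * x + + 1) (trans (ℤₚ.pos-+ (suc s ℕ.* suc s) (tri (suc s))) (cong (λ x → x + + tri (suc s)) (ℤₚ.pos-* (suc s) (suc s)))) ⟩
  + 24 * (x * x + + tri (suc s)) + + 1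
    ≡⟨ lemma₁ x (+ tri (suc s)) ⟩
  + 24 * (x * x) + + 12 * (+ 2 * + tri (suc s)) + + 1
    ≡⟨ cong (λ y → + 24 * (x * x) + + 12 * y + + 1) (tri-double (suc s)) ⟩
  + 24 * (x * x) + + 12 * (x * (x + + 1)) + + 1
    ≡⟨ lemma₂ x ⟩
  (+ 6 * (- x) - + 1) * (+ 6 * (- x) - + 1) ∎
  where
  open ≡-Reasoning
  x : ℤ
  x = + suc s
  lemma₁ : ∀ x t → + 24 * (x * x + t) + + 1 ≡ + 24 * (x * x) + + 12 * (+ 2 * t) + + 1
  lemma₁ = solve-∀
  lemma₂ : ∀ x → + 24 * (x * x) + + 12 * (x * (x + + 1)) + + 1 ≡ (+ 6 * (- x) - + 1) * (+ 6 * (- x) - + 1)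
  lemma₂ = solve-∀

-- The quadratic forms and the changes of variables between them

form : ℤ → ℤ → ℤ → ℤ² → ℤ
form a b c (x , y) = a * x * x + b * x * y + c * y * y

f₁ f₂ : ℤ² → ℤ
f₁ = form (+ 1) (+ 0) (+ 63)
f₂ = form (+ 7) (+ 0) (+ 9)

-- the exponent of q in the term of q E(−q³) E(−q²¹) indexed by (k , l)
κ : ℤ² → ℤ
κ (k , l) = + suc (pent k ℕ.* 3 ℕ.+ pent l ℕ.* 21)

-- Since 8 = 1 + 7 and 8 · 21 = 7 · 24, both squares are completed at once.
8κ : ∀ k l → + 8 * κ (k , l) ≡ (+ 6 * k - + 1) * (+ 6 * k - + 1) + + 7 * ((+ 6 * l - + 1) * (+ 6 * l - + 1))
8κ k l = begin
  + 8 * κ (k , l)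
    ≡⟨ cong (_*_ (+ 8)) (trans (ℤₚ.pos-+ 1 _) (cong (_+_ (+ 1)) (trans (ℤₚ.pos-+ (pent k ℕ.* 3) _)
         (cong₂ _+_ (ℤₚ.pos-* (pent k) 3) (ℤₚ.pos-* (pent l) 21))))) ⟩
  + 8 * (+ 1 + (+ pent k * + 3 + + pent l * + 21))
    ≡⟨ lemma (+ pent k) (+ pent l) ⟩
  (+ 24 * + pent k + + 1) + + 7 * (+ 24 * + pent l + + 1)
    ≡⟨ cong₂ (λ x y → x + + 7 * y) (pent-square k) (pent-square l) ⟩
  (+ 6 * k - + 1) * (+ 6 * k - + 1) + + 7 * ((+ 6 * l - + 1) * (+ 6 * l - + 1)) ∎
  where
  open ≡-Reasoning
  lemma : ∀ a b → + 8 * (+ 1 + (a * + 3 + b * + 21)) ≡ (+ 24 * a + + 1) + + 7 * (+ 24 * b + + 1)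
  lemma = solve-∀

-- Reduces a change of variables into `κ` to a polynomial identity free of `pent`.
κ-≡ : ∀ k l {x} → (+ 6 * k - + 1) * (+ 6 * k - + 1) + + 7 * ((+ 6 * l - + 1) * (+ 6 * l - + 1)) ≡ + 8 * x →
  κ (k , l) ≡ x
κ-≡ k l {x} eq = ℤₚ.*-cancelˡ-≡ (+ 8) (κ (k , l)) x (trans (8κ k l) eq)

-- 2 (y² + y z + 2 z²) at y = 3w, z = 3t + 1: the elements of norm n/2 of the maximal order of ℚ(√−7)
-- through which the representations by f₁ and f₂ of the same parity are compared.
g : ℤ² → ℤ
g (w , t) = + 2 * (+ 9 * w * w + + 3 * w * (+ 3 * t + + 1) + + 2 * (+ 3 * t + + 1) * (+ 3 * t + + 1))

-- For `h₁` and `h₂`, where x = 3a + 1, the superscript 0 means a + y even, hence x + y odd. The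
-- classes ⁰⁰, ⁰¹, ¹⁰, ¹¹ of `κ` are k - l ≡ 0, k - l ≡ 2, k + l ≡ 1, k + l ≡ 3 (mod 4).
h₁ h₂ h₁⁰ h₁¹ h₂⁰ h₂¹ κ⁰ κ¹ κ⁰⁰ κ⁰¹ κ¹⁰ κ¹¹ : ℤ² → ℤ
h₁  = f₁ ∘ to thirds ∘ inj₂ ∘ inj₁
h₂  = f₂ ∘ to thirds ∘ inj₂ ∘ inj₁
h₁⁰ = h₁ ∘ to parity ∘ inj₁
h₁¹ = h₁ ∘ to parity ∘ inj₂
h₂⁰ = h₂ ∘ to parity ∘ inj₁
h₂¹ = h₂ ∘ to parity ∘ inj₂
κ⁰  = κ ∘ to parity ∘ inj₁
κ¹  = κ ∘ to parity ∘ inj₂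
κ⁰⁰ = κ⁰ ∘ to parity ∘ inj₁
κ⁰¹ = κ⁰ ∘ to parity ∘ inj₂
κ¹⁰ = κ¹ ∘ to halves ∘ inj₁
κ¹¹ = κ¹ ∘ to halves ∘ inj₂

-- The map is 6k - 1 = 21y - x, 6l - 1 = -(x + 3y), that is, -(6k - 1) + (6l - 1)√-7 = (1 - √-7)(x -
-- 3y√-7); the norm of 1 - √-7 is 8.
h₁⁰↔κ⁰⁰ : ∀ {n} → Sol h₁⁰ n ↔ Sol κ⁰⁰ n
h₁⁰↔κ⁰⁰ = Sol-↔ φ (λ { (c , y) → κ-≡ (+ 2 * (+ 2 * (y - c) - - c) - - c) (- c) (lemma c y) })
  where
  i₁ : ∀ C l → C - l - - l ≡ C
  i₁ = solve-∀
  i₂ : ∀ c y → y - c - - c ≡ y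
  i₂ = solve-∀
  φ : ℤ² ↔ ℤ²
  φ = mk↔ₛ′ (λ { (c , y) → y - c , - c }) (λ { (C , l) → - l , C - l })
    (λ { (C , l) → cong₂ _,_ (i₁ C l) (ℤₚ.neg-involutive l) })
    (λ { (c , y) → cong₂ _,_ (ℤₚ.neg-involutive c) (i₂ c y) })
  lemma : ∀ c y →
    (+ 6 * (+ 2 * (+ 2 * (y - c) - - c) - - c) - + 1) * (+ 6 * (+ 2 * (+ 2 * (y - c) - - c) - - c) - + 1)
      + + 7 * ((+ 6 * - c - + 1) * (+ 6 * - c - + 1))
    ≡ + 8 * (+ 1 * (+ 3 * (+ 2 * c - y) + + 1) * (+ 3 * (+ 2 * c - y) + + 1)
      + + 0 * (+ 3 * (+ 2 * c - y) + + 1) * y + + 63 * y * y)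
  lemma = solve-∀

-- At w = 2y the form `g` is (2z + 3y)² + 63y² with z = 3t + 1, and x = -(2z + 3y).
h₁¹↔g : ∀ {n} → Sol h₁¹ n ↔ Sol (g ∘ to halves ∘ inj₁) n
h₁¹↔g = Sol-↔ φ (λ { (c , y) → lemma c y })
  where
  i : ∀ t → - (- t - + 1) - + 1 ≡ t
  i = solve-∀
  φ : ℤ² ↔ ℤ²
  φ = mk↔ₛ′ (λ { (c , y) → y , - c - + 1 }) (λ { (e , t) → - t - + 1 , e })
    (λ { (e , t) → cong₂ _,_ refl (i t) }) (λ { (c , y) → cong₂ _,_ (i c) refl })
  lemma : ∀ c y →
    + 2 * (+ 9 * (+ 2 * y) * (+ 2 * y) + + 3 * (+ 2 * y) * (+ 3 * (- c - + 1) + + 1)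
      + + 2 * (+ 3 * (- c - + 1) + + 1) * (+ 3 * (- c - + 1) + + 1))
    ≡ + 1 * (+ 3 * (+ 2 * c + + 1 - y) + + 1) * (+ 3 * (+ 2 * c + + 1 - y) + + 1)
      + + 0 * (+ 3 * (+ 2 * c + + 1 - y) + + 1) * y + + 63 * y * y
  lemma = solve-∀

-- With z = 3t + 1 and w = 2e + 1 the map is 6k - 1 = 2z - 9w, 6l - 1 = 2z + 3w.
g↔κ⁰¹ : ∀ {n} → Sol (g ∘ to halves ∘ inj₂) n ↔ Sol κ⁰¹ n
g↔κ⁰¹ = Sol-↔ φ (λ { (e , t) → κ-≡ (+ 2 * (+ 2 * t + + 1 - (t + e + + 1)) - (t + e + + 1)) (t + e + + 1) (lemma e t) })
  where
  i₁ : ∀ C l → C + (l - C - + 1) + + 1 ≡ l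
  i₁ = solve-∀
  i₂ : ∀ e t → t + e + + 1 - t - + 1 ≡ e
  i₂ = solve-∀
  φ : ℤ² ↔ ℤ²
  φ = mk↔ₛ′ (λ { (e , t) → t , t + e + + 1 }) (λ { (C , l) → l - C - + 1 , C })
    (λ { (C , l) → cong₂ _,_ refl (i₁ C l) }) (λ { (e , t) → cong₂ _,_ (i₂ e t) refl })
  lemma : ∀ e t →
    (+ 6 * (+ 2 * (+ 2 * t + + 1 - (t + e + + 1)) - (t + e + + 1)) - + 1)
      * (+ 6 * (+ 2 * (+ 2 * t + + 1 - (t + e + + 1)) - (t + e + + 1)) - + 1)
      + + 7 * ((+ 6 * (t + e + + 1) - + 1) * (+ 6 * (t + e + + 1) - + 1))
    ≡ + 8 * (+ 2 * (+ 9 * (+ 2 * e + + 1) * (+ 2 * e + + 1) + + 3 * (+ 2 * e + + 1) * (+ 3 * t + + 1)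
      + + 2 * (+ 3 * t + + 1) * (+ 3 * t + + 1)))
  lemma = solve-∀

-- With z = 3t + 1 and w = 2c - t the map is 6k - 1 = 9w + 5z, 6l - 1 = 3w - z.
g↔κ¹⁰ : ∀ {n} → Sol (g ∘ to parity ∘ inj₁) n ↔ Sol κ¹⁰ n
g↔κ¹⁰ = Sol-↔ φ (λ { (c , t) → κ-≡ (+ 2 * (+ 2 * c) + + 1 - (c - t)) (c - t) (lemma c t) })
  where
  i : ∀ c t → c - (c - t) ≡ t
  i = solve-∀
  φ : ℤ² ↔ ℤ²
  φ = mk↔ₛ′ (λ { (c , t) → c , c - t }) (λ { (C , l) → C , C - l })
    (λ { (C , l) → cong₂ _,_ refl (i C l) }) (λ { (c , t) → cong₂ _,_ refl (i c t) })
  lemma : ∀ c t →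
    (+ 6 * (+ 2 * (+ 2 * c) + + 1 - (c - t)) - + 1) * (+ 6 * (+ 2 * (+ 2 * c) + + 1 - (c - t)) - + 1)
      + + 7 * ((+ 6 * (c - t) - + 1) * (+ 6 * (c - t) - + 1))
    ≡ + 8 * (+ 2 * (+ 9 * (+ 2 * c - t) * (+ 2 * c - t) + + 3 * (+ 2 * c - t) * (+ 3 * t + + 1)
      + + 2 * (+ 3 * t + + 1) * (+ 3 * t + + 1)))
  lemma = solve-∀

-- Here w + z is even, and the map is x = -(3w + z)/2, y = (w - z)/2.
g↔h₂¹ : ∀ {n} → Sol (g ∘ to parity ∘ inj₂) n ↔ Sol h₂¹ n
g↔h₂¹ = Sol-↔ φ (λ { (c , t) → lemma c t })
  where
  i₁ : ∀ c → - (- c - + 1) - + 1 ≡ c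
  i₁ = solve-∀
  i₂ : ∀ c t → c - + 2 * t + + 2 * (- (- t - + 1) - + 1) ≡ c
  i₂ = solve-∀
  i₃ : ∀ c y → y + + 2 * (- c - + 1) - + 2 * (- c - + 1) ≡ y
  i₃ = solve-∀
  φ : ℤ² ↔ ℤ²
  φ = mk↔ₛ′ (λ { (c , t) → - t - + 1 , c - + 2 * t }) (λ { (c , y) → y + + 2 * (- c - + 1) , - c - + 1 })
    (λ { (c , y) → cong₂ _,_ (i₁ c) (i₃ c y) }) (λ { (c , t) → cong₂ _,_ (i₂ c t) (i₁ t) })
  lemma : ∀ c t →
    + 7 * (+ 3 * (+ 2 * (- t - + 1) + + 1 - (c - + 2 * t)) + + 1) * (+ 3 * (+ 2 * (- t - + 1) + + 1 - (c - + 2 * t)) + + 1)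
      + + 0 * (+ 3 * (+ 2 * (- t - + 1) + + 1 - (c - + 2 * t)) + + 1) * (c - + 2 * t) + + 9 * (c - + 2 * t) * (c - + 2 * t)
    ≡ + 2 * (+ 9 * (+ 2 * c + + 1 - t) * (+ 2 * c + + 1 - t) + + 3 * (+ 2 * c + + 1 - t) * (+ 3 * t + + 1)
      + + 2 * (+ 3 * t + + 1) * (+ 3 * t + + 1))
  lemma = solve-∀

-- The map is 6k - 1 = 3y - 7x, 6l - 1 = -(x + 3y), that is, (6k - 1) + (6l - 1)√-7 = (1 - √-7)(3y -
-- x√-7).
h₂⁰↔κ¹¹ : ∀ {n} → Sol h₂⁰ n ↔ Sol κ¹¹ n
h₂⁰↔κ¹¹ = Sol-↔ φ (λ { (c , y) → κ-≡ (+ 2 * (+ 2 * (y - + 2 * c - + 1) + + 1) + + 1 - - c) (- c) (lemma c y) })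
  where
  i₁ : ∀ C l → C - + 2 * l + + 1 - + 2 * - l - + 1 ≡ C
  i₁ = solve-∀
  i₂ : ∀ c y → y - + 2 * c - + 1 - + 2 * - c + + 1 ≡ y
  i₂ = solve-∀
  φ : ℤ² ↔ ℤ²
  φ = mk↔ₛ′ (λ { (c , y) → y - + 2 * c - + 1 , - c }) (λ { (C , l) → - l , C - + 2 * l + + 1 })
    (λ { (C , l) → cong₂ _,_ (i₁ C l) (ℤₚ.neg-involutive l) })
    (λ { (c , y) → cong₂ _,_ (ℤₚ.neg-involutive c) (i₂ c y) })
  lemma : ∀ c y →
    (+ 6 * (+ 2 * (+ 2 * (y - + 2 * c - + 1) + + 1) + + 1 - - c) - + 1) * (+ 6 * (+ 2 * (+ 2 * (y - + 2 * c - + 1) + + 1) + + 1 - - c) - + 1)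
      + + 7 * ((+ 6 * - c - + 1) * (+ 6 * - c - + 1))
    ≡ + 8 * (+ 7 * (+ 3 * (+ 2 * c - y) + + 1) * (+ 3 * (+ 2 * c - y) + + 1)
      + + 0 * (+ 3 * (+ 2 * c - y) + + 1) * y + + 9 * y * y)
  lemma = solve-∀

-- At x = 3a the forms are 9a² + 63y² and 63a² + 9y², which differ by exchanging the variables.
f₁-thirds↔f₂-thirds : ∀ {n} → Sol (f₁ ∘ to thirds ∘ inj₁) n ↔ Sol (f₂ ∘ to thirds ∘ inj₁) n
f₁-thirds↔f₂-thirds = Sol-↔ φ (λ { (a , y) → lemma a y })
  where
  φ : ℤ² ↔ ℤ²
  φ = mk↔ₛ′ (λ { (a , y) → y , a }) (λ { (a , y) → y , a }) (λ _ → refl) (λ _ → refl)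
  lemma : ∀ a y → + 7 * (+ 3 * y) * (+ 3 * y) + + 0 * (+ 3 * y) * a + + 9 * a * a
    ≡ + 1 * (+ 3 * a) * (+ 3 * a) + + 0 * (+ 3 * a) * y + + 63 * y * y
  lemma = solve-∀

form-neg : ∀ a c x y → a * x * x + + 0 * x * y + c * y * y ≡ a * - x * - x + + 0 * - x * y + c * y * y
form-neg = solve-∀

-- Signs on the four classes of (k , l)

weight : ℤ² → ℤ
weight (k , l) = ε k * ε l

-- Here k ≡ l (mod 4), so the product is a square; in `weight⁰¹` an additional 2 flips the sign.
weight⁰⁰ : ∀ p → weight (to parity (inj₁ (to parity (inj₁ p)))) ≡ 1ℤ
weight⁰⁰ (c , l) = trans (cong (λ k → ε k * ε l) (lemma c l)) (trans (cong (_* ε l) (ε-+4 l (c - l))) (ε² l))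
  where
  lemma : ∀ c l → + 2 * (+ 2 * c - l) - l ≡ l + + 4 * (c - l)
  lemma = solve-∀

weight⁰¹ : ∀ p → weight (to parity (inj₁ (to parity (inj₂ p)))) ≡ -1ℤ
weight⁰¹ (c , l) = begin
  ε (+ 2 * (+ 2 * c + + 1 - l) - l) * ε l     ≡⟨ cong (λ k → ε k * ε l) (lemma c l) ⟩
  ε (l + + 4 * (c - l) + + 2) * ε l           ≡⟨ cong (_* ε l) (trans (ε-+2 (l + + 4 * (c - l))) (cong -_ (ε-+4 l (c - l)))) ⟩
  - ε l * ε l                                 ≡⟨ trans (sym (ℤₚ.neg-distribˡ-* (ε l) (ε l))) (cong -_ (ε² l)) ⟩
  -1ℤ                                         ∎
  where
  open ≡-Reasoning
  lemma : ∀ c l → + 2 * (+ 2 * c + + 1 - l) - l ≡ l + + 4 * (c - l) + + 2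
  lemma = solve-∀

-- Here k ≡ 1 - l (mod 4), and `ε` is invariant under l ↦ 1 - l; in `weight¹¹` an additional 2 flips
-- the sign.
weight¹⁰ : ∀ p → weight (to parity (inj₂ (to halves (inj₁ p)))) ≡ 1ℤ
weight¹⁰ (c , l) = trans (cong (λ k → ε k * ε l) (lemma c l))
  (trans (cong (_* ε l) (trans (ε-+4 (+ 1 - l) c) (ε-1- l))) (ε² l))
  where
  lemma : ∀ c l → + 2 * (+ 2 * c) + + 1 - l ≡ + 1 - l + + 4 * c
  lemma = solve-∀

weight¹¹ : ∀ p → weight (to parity (inj₂ (to halves (inj₂ p)))) ≡ -1ℤ
weight¹¹ (c , l) = begin
  ε (+ 2 * (+ 2 * c + + 1) + + 1 - l) * ε l   ≡⟨ cong (λ k → ε k * ε l) (lemma c l) ⟩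
  ε (+ 1 - l + + 4 * c + + 2) * ε l           ≡⟨ cong (_* ε l) (trans (ε-+2 (+ 1 - l + + 4 * c)) (cong -_ (trans (ε-+4 (+ 1 - l) c) (ε-1- l)))) ⟩
  - ε l * ε l                                 ≡⟨ trans (sym (ℤₚ.neg-distribˡ-* (ε l) (ε l))) (cong -_ (ε² l)) ⟩
  -1ℤ                                         ∎
  where
  open ≡-Reasoning
  lemma : ∀ c l → + 2 * (+ 2 * c + + 1) + + 1 - l ≡ + 1 - l + + 4 * c + + 2
  lemma = solve-∀

-- Comparison of the numbers of solutions

module _ {n : ℤ} where

  open ≡-Reasoning

  -- The middle coefficient is 0, so x ↦ -x preserves the form and the classes of 1 and -1 modulo 3
  -- have the same size.
  by-thirds : ∀ a c → let f = form a (+ 0) c in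
    (e : Enum (Sol f n)) (z : Enum (Sol (f ∘ to thirds ∘ inj₁) n)) (h : Enum (Sol (f ∘ to thirds ∘ inj₂ ∘ inj₁) n)) →
    card e ≡ card z + (card h + card h)
  by-thirds a c e z h = begin
    card e                             ≡⟨ ∑ᴱ-⊎ (Sol-⊎ thirds) z r e (λ _ → 1ℤ) ⟩
    card z + card r                    ≡⟨ cong (_+_ (card z)) (∑ᴱ-⊎ (Sol-⊎ (↔-id _)) h h′ r (λ _ → 1ℤ)) ⟩
    card z + (card h + card h′)        ≡⟨ cong (λ x → card z + (card h + x)) (∑ᴱ-↔ negate h h′ (λ _ → 1ℤ)) ⟩
    card z + (card h + card h)         ∎
    where
    f : ℤ² → ℤ
    f = form a (+ 0) c
    r : Enum (Sol (f ∘ to thirds ∘ inj₂) n)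
    r = Enum-right (Enum-↔ (↔-sym (Sol-⊎ {r = f} thirds)) e)
    h′ : Enum (Sol (f ∘ to thirds ∘ inj₂ ∘ inj₂) n)
    h′ = Enum-right (Enum-↔ (↔-sym (Sol-⊎ (↔-id _))) r)
    negate : Sol (f ∘ to thirds ∘ inj₂ ∘ inj₁) n ↔ Sol (f ∘ to thirds ∘ inj₂ ∘ inj₂) n
    negate = Sol-↔ (↔-id _) (λ { (b , y) → sym (form-neg a c (+ 3 * b + + 1) y) })

  module _ (e₁ : Enum (Sol f₁ n)) (e₂ : Enum (Sol f₂ n)) (e : Enum (Sol κ n)) where

    split : {I J K : Set} {r : K → ℤ} (φ : (I ⊎ J) ↔ K) → Enum (Sol r n) →
      Enum (Sol (r ∘ to φ ∘ inj₁) n ⊎ Sol (r ∘ to φ ∘ inj₂) n)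
    split {r = r} φ = Enum-↔ (↔-sym (Sol-⊎ {r = r} φ))

    Eh₁ : Enum (Sol h₁ n)
    Eh₁ = Enum-left (split (↔-id _) (Enum-right (split thirds e₁)))
    Eh₂ : Enum (Sol h₂ n)
    Eh₂ = Enum-left (split (↔-id _) (Enum-right (split thirds e₂)))
    Eh₁⁰ : Enum (Sol h₁⁰ n)
    Eh₁⁰ = Enum-left (split parity Eh₁)
    Eh₁¹ : Enum (Sol h₁¹ n)
    Eh₁¹ = Enum-right (split parity Eh₁)
    Eh₂⁰ : Enum (Sol h₂⁰ n)
    Eh₂⁰ = Enum-left (split parity Eh₂)
    Eh₂¹ : Enum (Sol h₂¹ n)
    Eh₂¹ = Enum-right (split parity Eh₂)
    Eκ⁰ : Enum (Sol κ⁰ n)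
    Eκ⁰ = Enum-left (split parity e)
    Eκ¹ : Enum (Sol κ¹ n)
    Eκ¹ = Enum-right (split parity e)
    Eκ⁰⁰ : Enum (Sol κ⁰⁰ n)
    Eκ⁰⁰ = Enum-left (split parity Eκ⁰)
    Eκ⁰¹ : Enum (Sol κ⁰¹ n)
    Eκ⁰¹ = Enum-right (split parity Eκ⁰)
    Eκ¹⁰ : Enum (Sol κ¹⁰ n)
    Eκ¹⁰ = Enum-left (split halves Eκ¹)
    Eκ¹¹ : Enum (Sol κ¹¹ n)
    Eκ¹¹ = Enum-right (split halves Eκ¹)

    1ᶜ : {A : Set} → A → ℤ
    1ᶜ _ = 1ℤ

    card-h₁ : card Eh₁ ≡ card Eκ⁰⁰ + card Eh₁¹
    card-h₁ = trans (∑ᴱ-⊎ (Sol-⊎ {r = h₁} parity) Eh₁⁰ Eh₁¹ Eh₁ 1ᶜ)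
      (cong (_+ card Eh₁¹) (sym (∑ᴱ-↔ h₁⁰↔κ⁰⁰ Eh₁⁰ Eκ⁰⁰ 1ᶜ)))

    card-h₂ : card Eh₂ ≡ card Eκ¹¹ + card Eh₂¹
    card-h₂ = trans (∑ᴱ-⊎ (Sol-⊎ {r = h₂} parity) Eh₂⁰ Eh₂¹ Eh₂ 1ᶜ)
      (cong (_+ card Eh₂¹) (sym (∑ᴱ-↔ h₂⁰↔κ¹¹ Eh₂⁰ Eκ¹¹ 1ᶜ)))

    Sol-g₁ : (Sol h₁¹ n ⊎ Sol κ⁰¹ n) ↔ Sol g n
    Sol-g₁ = Sol-⊎ {r = g} halves ↔-∘ (h₁¹↔g ⊎-↔ ↔-sym g↔κ⁰¹)

    Sol-g₂ : (Sol κ¹⁰ n ⊎ Sol h₂¹ n) ↔ Sol g n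
    Sol-g₂ = Sol-⊎ {r = g} parity ↔-∘ (↔-sym g↔κ¹⁰ ⊎-↔ ↔-sym g↔h₂¹)

    -- Both sides count the solutions of `g`, sorted by the parity of w on the left and of w + t on
    -- the right.
    exchange : card Eh₁¹ + card Eκ⁰¹ ≡ card Eκ¹⁰ + card Eh₂¹
    exchange = trans (sym (∑ᴱ-⊎ Sol-g₁ Eh₁¹ Eκ⁰¹ Eg 1ᶜ)) (∑ᴱ-⊎ Sol-g₂ Eκ¹⁰ Eh₂¹ Eg 1ᶜ)
      where
      Eg : Enum (Sol g n)
      -- Finiteness for `g` is assembled from the pieces of the first sorting.
      Eg = Enum-↔ Sol-g₁ (Enum-⊎ Eh₁¹ Eκ⁰¹)

    ∑-weight : ∑ᴱ e (weight ∘ proj₁) ≡ (card Eκ⁰⁰ - card Eκ⁰¹) + (card Eκ¹⁰ - card Eκ¹¹)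
    ∑-weight = trans (∑ᴱ-⊎ (Sol-⊎ {r = κ} parity) Eκ⁰ Eκ¹ e (weight ∘ proj₁)) (cong₂ _+_
      (trans (∑ᴱ-⊎ (Sol-⊎ {r = κ⁰} parity) Eκ⁰⁰ Eκ⁰¹ Eκ⁰ _)
        (cong₂ _+_ (∑ᴱ-one Eκ⁰⁰ (weight⁰⁰ ∘ proj₁)) (∑ᴱ-minus-one Eκ⁰¹ (weight⁰¹ ∘ proj₁))))
      (trans (∑ᴱ-⊎ (Sol-⊎ {r = κ¹} halves) Eκ¹⁰ Eκ¹¹ Eκ¹ _)
        (cong₂ _+_ (∑ᴱ-one Eκ¹⁰ (weight¹⁰ ∘ proj₁)) (∑ᴱ-minus-one Eκ¹¹ (weight¹¹ ∘ proj₁)))))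

    card-difference : card e₁ - card e₂ ≡ + 2 * ∑ᴱ e (weight ∘ proj₁)
    card-difference = begin
      card e₁ - card e₂
        ≡⟨ cong₂ _-_ (by-thirds (+ 1) (+ 63) e₁ Ez Eh₁) (by-thirds (+ 7) (+ 9) e₂ Ez′ Eh₂) ⟩
      (card Ez + (card Eh₁ + card Eh₁)) - (card Ez′ + (card Eh₂ + card Eh₂))
        -- The solutions with 3 ∣ x will cancel.
        ≡⟨ cong (λ z → (card Ez + (card Eh₁ + card Eh₁)) - (z + (card Eh₂ + card Eh₂))) (∑ᴱ-↔ f₁-thirds↔f₂-thirds Ez Ez′ 1ᶜ) ⟩
      (card Ez + (card Eh₁ + card Eh₁)) - (card Ez + (card Eh₂ + card Eh₂))
        ≡⟨ cong₂ (λ x y → (card Ez + (x + x)) - (card Ez + (y + y))) card-h₁ card-h₂ ⟩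
      (card Ez + ((a + p) + (a + p))) - (card Ez + ((d + q) + (d + q)))
        -- Adding and subtracting b produces p + b, to which `exchange` applies.
        ≡⟨ lemma (card Ez) a b d p q ⟩
      + 2 * ((a - b) + ((p + b) - q - d))
        ≡⟨ cong (λ x → + 2 * ((a - b) + (x - q - d))) exchange ⟩
      + 2 * ((a - b) + ((c + q) - q - d))
        ≡⟨ lemma′ a b c d q ⟩
      + 2 * ((a - b) + (c - d))
        ≡⟨ cong (_*_ (+ 2)) (sym ∑-weight) ⟩
      + 2 * ∑ᴱ e (weight ∘ proj₁) ∎
      where
      Ez : Enum (Sol (f₁ ∘ to thirds ∘ inj₁) n)
      Ez = Enum-left (split thirds e₁)
      Ez′ : Enum (Sol (f₂ ∘ to thirds ∘ inj₁) n)
      Ez′ = Enum-left (split thirds e₂)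
      a b c d p q : ℤ
      a = card Eκ⁰⁰
      b = card Eκ⁰¹
      c = card Eκ¹⁰
      d = card Eκ¹¹
      p = card Eh₁¹
      q = card Eh₂¹
      lemma : ∀ z a b d p q → (z + ((a + p) + (a + p))) - (z + ((d + q) + (d + q))) ≡ + 2 * ((a - b) + ((p + b) - q - d))
      lemma = solve-∀
      lemma′ : ∀ a b c d q → + 2 * ((a - b) + ((c + q) - q - d)) ≡ + 2 * ((a - b) + (c - d))
      lemma′ = solve-∀

-- Search boxes, and theta coefficients as cardinalities

range-unique : ∀ n → Unique (range n)
range-unique n = Unique.map⁺ (λ {i} {j} eq → ℤₚ.+-injective (+-cancelʳ (- (+ n)) (+ i) (+ j) eq)) (Unique.upTo⁺ (suc (n ℕ.+ n)))

∈-range : ∀ n {x} → ∣ x ∣ ℕ.≤ n → x ∈ range n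
∈-range n {+ m}      m≤n = subst (_∈ range n) (trans (cong (_- + n) (ℤₚ.pos-+ m n)) (lemma (+ m) (+ n)))
  (∈-map⁺ (λ i → + i - + n) (∈-upTo⁺ (s≤s (ℕₚ.+-monoˡ-≤ n m≤n))))
  where
  lemma : ∀ m n → m + n - n ≡ m
  lemma = solve-∀
∈-range n { -[1+ m ]} m<n = subst (_∈ range n) i-n≡x
  (∈-map⁺ (λ i → + i - + n) (∈-upTo⁺ (s≤s (ℕₚ.≤-trans (ℕₚ.m∸n≤m n (suc m)) (ℕₚ.m≤m+n n n)))))
  where
  i : ℕ
  i = n ℕ.∸ suc m
  lemma : ∀ i m → i - (m + i) ≡ - m
  lemma = solve-∀
  i-n≡x : + i - + n ≡ -[1+ m ]
  i-n≡x = trans (cong (λ k → + i - k) (trans (cong +_ (sym (ℕₚ.m+[n∸m]≡n m<n))) (ℤₚ.pos-+ (suc m) i))) (lemma (+ i) (+ suc m))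

square : ∀ x → x * x ≡ + (∣ x ∣ ℕ.* ∣ x ∣)
square (+ m)    = sym (ℤₚ.pos-* m m)
square -[1+ m ] = refl

m≤m*m : ∀ m → m ℕ.≤ m ℕ.* m
m≤m*m zero    = z≤n
m≤m*m (suc m) = ℕₚ.m≤m*n (suc m) (suc m)

-- Both summands are nonnegative, and |x| ≤ x² for integers.
form-bound : ∀ a c {x y n} → form (+ suc a) (+ 0) (+ suc c) (x , y) ≡ + n → ∣ x ∣ ℕ.≤ n × ∣ y ∣ ℕ.≤ n
form-bound a c {x} {y} {n} eq =
    ℕₚ.≤-trans (m≤ a ∣ x ∣) (ℕₚ.≤-trans (ℕₚ.m≤m+n X Y) (ℕₚ.≤-reflexive X+Y≡n))
  , ℕₚ.≤-trans (m≤ c ∣ y ∣) (ℕₚ.≤-trans (ℕₚ.m≤n+m Y X) (ℕₚ.≤-reflexive X+Y≡n))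
  where
  X Y : ℕ
  X = suc a ℕ.* (∣ x ∣ ℕ.* ∣ x ∣)
  Y = suc c ℕ.* (∣ y ∣ ℕ.* ∣ y ∣)
  m≤ : ∀ a m → m ℕ.≤ suc a ℕ.* (m ℕ.* m)
  m≤ a m = ℕₚ.≤-trans (m≤m*m m) (ℕₚ.m≤n*m (m ℕ.* m) (suc a))
  lemma : ∀ a c x y → a * x * x + + 0 * x * y + c * y * y ≡ a * (x * x) + c * (y * y)
  lemma = solve-∀
  pos : ∀ a x → + suc a * (x * x) ≡ + (suc a ℕ.* (∣ x ∣ ℕ.* ∣ x ∣))
  pos a x = trans (cong (_*_ (+ suc a)) (square x)) (sym (ℤₚ.pos-* (suc a) (∣ x ∣ ℕ.* ∣ x ∣)))
  X+Y≡n : X ℕ.+ Y ≡ n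
  X+Y≡n = ℤₚ.+-injective (trans (ℤₚ.pos-+ X Y) (trans (cong₂ _+_ (sym (pos a x)) (sym (pos c y)))
    (trans (sym (lemma (+ suc a) (+ suc c) x y)) eq)))

Enum-form : ∀ a c n → Enum (Sol (form (+ suc a) (+ 0) (+ suc c)) (+ n))
Enum-form a c n = Enum-collect (λ p → form (+ suc a) (+ 0) (+ suc c) p ℤ.≟ + n) ≡-irrelevant
  (Unique.cartesianProduct⁺ (range-unique n) (range-unique n))
  (λ {p} eq → let ∣x∣≤n , ∣y∣≤n = form-bound a c {proj₁ p} {proj₂ p} eq in
    ∈-cartesianProduct⁺ (∈-range n ∣x∣≤n) (∈-range n ∣y∣≤n))

concatMap-cartesianProduct : {A B : Set} (xs : List A) (ys : List B) →
  concatMap (λ x → map (λ y → (x , y)) ys) xs ≡ cartesianProduct xs ys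
concatMap-cartesianProduct []       ys = refl
concatMap-cartesianProduct (x ∷ xs) ys = cong (map (x ,_) ys ++_) (concatMap-cartesianProduct xs ys)

theta-card : ∀ a c n → theta (+ suc a) (+ 0) (+ suc c) n ≡ card (Enum-form a c n)
theta-card a c n = trans
  (cong (λ ps → + length (filter Q? ps)) (concatMap-cartesianProduct (range n) (range n)))
  (length-filter Q? (cartesianProduct (range n) (range n)))
  where
  Q? : ∀ p → Dec (form (+ suc a) (+ 0) (+ suc c) p ≡ + n)
  Q? p = form (+ suc a) (+ 0) (+ suc c) p ℤ.≟ + n

∈-ball⁺ : ∀ N {k} → ∣ k ∣ ℕ.≤ N → k ∈ ball N
∈-ball⁺ zero    {+ zero}   k≤N = here refl
∈-ball⁺ (suc N) {k}        k≤N with ℕₚ.m≤n⇒m<n∨m≡n k≤N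
∈-ball⁺ (suc N) {k}        k≤N | inj₁ (s≤s k≤N′) = there (there (∈-ball⁺ N k≤N′))
∈-ball⁺ (suc N) {+ _}      k≤N | inj₂ refl = here refl
∈-ball⁺ (suc N) { -[1+ _ ]} k≤N | inj₂ refl = there (here refl)

∈-ball⁻ : ∀ N {k} → k ∈ ball N → ∣ k ∣ ℕ.≤ N
∈-ball⁻ zero    (here refl)         = z≤n
∈-ball⁻ (suc N) (here refl)         = ℕₚ.≤-refl
∈-ball⁻ (suc N) (there (here refl)) = ℕₚ.≤-refl
∈-ball⁻ (suc N) (there (there k∈))  = ℕₚ.m≤n⇒m≤1+n (∈-ball⁻ N k∈)

ball-unique : ∀ N → Unique (ball N)
ball-unique zero    = [] ∷ []
ball-unique (suc N) =
  ((λ ()) ∷ All.tabulate (λ { k∈ refl → ℕₚ.<-irrefl refl (∈-ball⁻ N k∈) }))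
  ∷ All.tabulate (λ { k∈ refl → ℕₚ.<-irrefl refl (∈-ball⁻ N k∈) })
  ∷ ball-unique N

-- Off zero, `pent k` contains k² as a summand. This confines the solutions of `κ` to a finite box.
∣k∣≤pent : ∀ k → ∣ k ∣ ℕ.≤ pent k
∣k∣≤pent (+ zero)  = z≤n
∣k∣≤pent (+ suc s) = ℕₚ.≤-trans (m≤m*m (suc s)) (ℕₚ.m≤m+n _ (tri s))
∣k∣≤pent -[1+ s ]  = ℕₚ.≤-trans (m≤m*m (suc s)) (ℕₚ.m≤m+n _ (tri (suc s)))

κ-injective : ∀ k l {m} → κ (k , l) ≡ + suc m → pent k ℕ.* 3 ℕ.+ pent l ℕ.* 21 ≡ m
κ-injective k l eq = ℕₚ.suc-injective (ℤₚ.+-injective eq)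

Enum-κ : ∀ m → Enum (Sol κ (+ suc m))
Enum-κ m = Enum-collect (λ p → κ p ℤ.≟ + suc m) ≡-irrelevant
  (Unique.cartesianProduct⁺ (ball-unique m) (ball-unique m))
  (λ { {k , l} eq → ∈-cartesianProduct⁺
    (∈-ball⁺ m (bound k 3 (ℕₚ.≤-trans (ℕₚ.m≤m+n _ _) (ℕₚ.≤-reflexive (κ-injective k l eq)))))
    (∈-ball⁺ m (bound l 21 (ℕₚ.≤-trans (ℕₚ.m≤n+m _ (pent k ℕ.* 3)) (ℕₚ.≤-reflexive (κ-injective k l eq))))) })
  where
  bound : ∀ k c .{{_ : ℕ.NonZero c}} → pent k ℕ.* c ℕ.≤ m → ∣ k ∣ ℕ.≤ m
  bound k c ≤m = ℕₚ.≤-trans (∣k∣≤pent k) (ℕₚ.≤-trans (ℕₚ.m≤m*n (pent k) c) ≤m)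

-- The product of the two pentagonal series, and the identity

⊛-monomial : ∀ a b → monomial a ⊛ monomial b ≋ monomial (a ℕ.+ b)
⊛-monomial a b n = begin
  (monomial a ⊛ monomial b) n     ≡⟨ ⊛-congʳ (monomial a) (λ i → sym (shift-one b i)) n ⟩
  (monomial a ⊛ shift b one) n    ≡⟨ ⊛-shiftʳ b (monomial a) one n ⟩
  shift b (monomial a ⊛ one) n    ≡⟨ shift-cong b (⊛-oneʳ (monomial a)) n ⟩
  shift b (monomial a) n          ≡⟨ shift-cong b (λ i → sym (shift-one a i)) n ⟩
  shift b (shift a one) n         ≡⟨ cong (λ s → s n) (sym (shift-+ b a one)) ⟩
  shift (b ℕ.+ a) one n           ≡⟨ shift-one (b ℕ.+ a) n ⟩
  monomial (b ℕ.+ a) n            ≡⟨ cong (λ c → monomial c n) (ℕₚ.+-comm b a) ⟩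
  monomial (a ℕ.+ b) n            ∎
  where open ≡-Reasoning

∑-⊛-∑ : {A B : Set} (xs : List A) (ys : List B) (a : A → ℤ) (b : B → ℤ) (f : A → Series) (g : B → Series) (n : ℕ) →
  ((λ i → ∑ xs (λ x → a x * f x i)) ⊛ (λ i → ∑ ys (λ y → b y * g y i))) n
    ≡ ∑ xs (λ x → ∑ ys (λ y → a x * b y * (f x ⊛ g y) n))
∑-⊛-∑ xs ys a b f g n = begin
  ∑ is (λ i → ∑ xs (λ x → a x * f x i) * ∑ ys (λ y → b y * g y (n ℕ.∸ i)))
    ≡⟨ ∑-cong is (λ i → trans (sym (∑-*ʳ (∑ ys (λ y → b y * g y (n ℕ.∸ i))) (λ x → a x * f x i) xs))
         (∑-cong xs (λ x → sym (∑-*ˡ (a x * f x i) (λ y → b y * g y (n ℕ.∸ i)) ys)))) ⟩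
  ∑ is (λ i → ∑ xs (λ x → ∑ ys (λ y → a x * f x i * (b y * g y (n ℕ.∸ i)))))
    ≡⟨ ∑-swap (λ i x → ∑ ys (λ y → a x * f x i * (b y * g y (n ℕ.∸ i)))) is xs ⟩
  ∑ xs (λ x → ∑ is (λ i → ∑ ys (λ y → a x * f x i * (b y * g y (n ℕ.∸ i)))))
    ≡⟨ ∑-cong xs (λ x → ∑-swap (λ i y → a x * f x i * (b y * g y (n ℕ.∸ i))) is ys) ⟩
  ∑ xs (λ x → ∑ ys (λ y → ∑ is (λ i → a x * f x i * (b y * g y (n ℕ.∸ i)))))
    ≡⟨ ∑-cong xs (λ x → ∑-cong ys (λ y → trans
         (∑-cong is (λ i → lemma (a x) (f x i) (b y) (g y (n ℕ.∸ i))))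
         (∑-*ˡ (a x * b y) (λ i → f x i * g y (n ℕ.∸ i)) is))) ⟩
  ∑ xs (λ x → ∑ ys (λ y → a x * b y * (f x ⊛ g y) n)) ∎
  where
  open ≡-Reasoning
  is : List ℕ
  is = upTo (suc n)
  lemma : ∀ a f b g → a * f * (b * g) ≡ a * b * (f * g)
  lemma = solve-∀

E-product : ∀ m → (Esub (negS (monomial 3)) ⊛ Esub (negS (monomial 21))) m ≡ ∑ᴱ (Enum-κ m) (weight ∘ proj₁)
E-product m = begin
  (Esub (negS (monomial 3)) ⊛ Esub (negS (monomial 21))) m
    -- Both i and m - i are at most m, so both factors expand over `ball m`. The parameters 2 and 20
    -- stand for c = 3 and c = 21.
    ≡⟨ ∑-cong-∈ (upTo (suc m)) (λ {i} i∈ → cong₂ _*_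
         (Pentagonal.pentagonal 2 (ℕₚ.≤-pred (∈-upTo⁻ i∈))) (Pentagonal.pentagonal 20 (ℕₚ.m∸n≤m m i))) ⟩
  ((λ i → ∑ (ball m) (λ k → ε k * monomial (pent k ℕ.* 3) i)) ⊛ (λ i → ∑ (ball m) (λ l → ε l * monomial (pent l ℕ.* 21) i))) m
    ≡⟨ ∑-⊛-∑ (ball m) (ball m) ε ε (λ k → monomial (pent k ℕ.* 3)) (λ l → monomial (pent l ℕ.* 21)) m ⟩
  ∑ (ball m) (λ k → ∑ (ball m) (λ l → ε k * ε l * (monomial (pent k ℕ.* 3) ⊛ monomial (pent l ℕ.* 21)) m))
    ≡⟨ ∑-cong (ball m) (λ k → ∑-cong (ball m) (λ l → cong (_*_ (ε k * ε l)) (⊛-monomial (pent k ℕ.* 3) (pent l ℕ.* 21) m))) ⟩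
  ∑ (ball m) (λ k → ∑ (ball m) (λ l → F (k , l)))
    ≡⟨ sym (∑-cartesianProduct F (ball m) (ball m)) ⟩
  ∑ (cartesianProduct (ball m) (ball m)) F
    -- The monomial coefficient is the indicator of `κ` = m + 1.
    ≡⟨ sym (∑-collect (λ p → κ p ℤ.≟ + suc m) weight F (λ {p} → on (proj₁ p) (proj₂ p)) (λ {p} → off (proj₁ p) (proj₂ p))
         (cartesianProduct (ball m) (ball m))) ⟩
  ∑ᴱ (Enum-κ m) (weight ∘ proj₁) ∎
  where
  open ≡-Reasoning
  F : ℤ² → ℤ
  F (k , l) = ε k * ε l * monomial (pent k ℕ.* 3 ℕ.+ pent l ℕ.* 21) m
  on : ∀ k l → κ (k , l) ≡ + suc m → F (k , l) ≡ weight (k , l)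
  on k l eq = trans (cong (_*_ (ε k * ε l)) (monomial-≡ (κ-injective k l eq))) (ℤₚ.*-identityʳ (ε k * ε l))
  off : ∀ k l → κ (k , l) ≢ + suc m → F (k , l) ≡ 0ℤ
  off k l ≢m = trans (cong (_*_ (ε k * ε l)) (monomial-≢ (≢m ∘ cong (+_ ∘ suc)))) (ℤₚ.*-zeroʳ (ε k * ε l))

theorem5p3 : (n : ℕ) →
    theta (+ 1) (+ 0) (+ 63) n - theta (+ 7) (+ 0) (+ 9) n
    ≡ + 2 * qTimes (Esub (negS (monomial 3)) ⊛ Esub (negS (monomial 21))) n
-- Each search box is the single point (0 , 0), counted once by each form.
theorem5p3 zero    = refl
theorem5p3 (suc m) = begin
  theta (+ 1) (+ 0) (+ 63) (suc m) - theta (+ 7) (+ 0) (+ 9) (suc m)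
    ≡⟨ cong₂ _-_ (theta-card 0 62 (suc m)) (theta-card 6 8 (suc m)) ⟩
  card (Enum-form 0 62 (suc m)) - card (Enum-form 6 8 (suc m))
    ≡⟨ card-difference (Enum-form 0 62 (suc m)) (Enum-form 6 8 (suc m)) (Enum-κ m) ⟩
  + 2 * ∑ᴱ (Enum-κ m) (weight ∘ proj₁)
    -- The factor q lowers the index from m + 1 to m, which matches the `suc` in `κ`.
    ≡⟨ cong (_*_ (+ 2)) (sym (E-product m)) ⟩
  + 2 * (Esub (negS (monomial 3)) ⊛ Esub (negS (monomial 21))) m ∎
  where open ≡-Reasoning
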